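{- For constant $\epsilon$, there is a 1-sided error distributed property-testing algorithm for $K_5$-freeness in the CONGEST model with running time $O(m^{1/6})$ rounds, where $m$ is the number of edges of the network graph (the nodes are assumed to know $m$ up to a constant factor).
   Context: CONGEST model: the network is an undirected graph $G=(V,E)$ with $n=|V|$ nodes and $m=|E|$ edges, nodes have unique $O(\log n)$-bit identifiers; computation is synchronous, and in each round every node may send $O(\log n)$ bits over each incident edge; nodes have private randomness. $K_5$ is the clique on $5$ vertices. $G$ is $K_5$-free if it contains no subgraph isomorphic to $K_5$. $G$ is $\epsilon$-far from a property if at least $\epsilon|E|$ edges must be added to or removed from $E$ to obtain a graph with the property. Testing $K_5$-freeness with parameter $0<\epsilon\le 1$ (known to the algorithm): if $G$ is $K_5$-free then with probability at least $2/3$ all nodes accept; if $G$ is $\epsilon$-far from $K_5$-free then with probability at least $2/3$ some node rejects. The algorithm has 1-sided error if, whenever $G$ is $K_5$-free, all nodes accept with probability 1. -}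

module Defs where

open import Data.Bool.Base using (Bool; true; false; T; not; _xor_)
open import Data.Bool.ListAction using (all; any)
open import Data.Fin.Base using (Fin)
open import Data.Fin.Properties using (_≟_; _<?_)
open import Data.Integer.Base using (+_)
open import Data.List.Base
  using (List; []; _∷_; length; filter; filterᵇ; allFin;
         cartesianProduct; cartesianProductWith)
open import Data.Nat.Base using (ℕ; zero; suc; _*_; _^_; _≤_; _<_)
open import Data.Nat.Logarithm using (⌈log₂_⌉)
open import Data.Nat.Properties using (m^n≢0)
open import Data.Product.Base using (Σ; ∃; _×_; _,_)
open import Data.Rational.Base as ℚ using (ℚ; 1ℚ; _/_)
open import Data.Vec.Base as Vec using (Vec)
open import Function.Bundles using (_↔_; Inverse)
open import Function.Definitions using (Injective)
open import Relation.Binary.PropositionalEquality using (_≡_; refl; ≢-sym)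
open import Relation.Nullary using (¬_; ¬?)
open import Relation.Nullary.Decidable using (isYes; toWitness; fromWitness)

record Graph (n : ℕ) : Set where
  field
    adj        : Fin n → Fin n → Bool
    adj-sym    : ∀ {u v} → T (adj u v) → T (adj v u)
    adj-irrefl : ∀ {v} → ¬ T (adj v v)

open Graph public

pairs : ∀ n → List (Fin n × Fin n)
pairs n = filter (λ (u , v) → u <? v) (cartesianProduct (allFin n) (allFin n))

∣E_∣ : ∀ {n} → Graph n → ℕ
∣E_∣ {n} G = length (filterᵇ (λ (u , v) → adj G u v) (pairs n))

editDistance : ∀ {n} → Graph n → Graph n → ℕ
editDistance {n} G H =
  length (filterᵇ (λ (u , v) → adj G u v xor adj H u v) (pairs n))

complete : ∀ k → Graph k
complete k = record
  { adj        = λ u v → isYes (¬? (u ≟ v))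
  ; adj-sym    = λ {u} {v} e →
      fromWitness {a? = ¬? (v ≟ u)} (≢-sym (toWitness {a? = ¬? (u ≟ v)} e))
  ; adj-irrefl = λ {v} e → toWitness {a? = ¬? (v ≟ v)} e refl
  }

-- G has a (not necessarily induced) subgraph isomorphic to H.
Contains : ∀ {k n} → Graph k → Graph n → Set
Contains {k} {n} H G =
  Σ (Fin k → Fin n) λ f →
    Injective _≡_ _≡_ f × (∀ {i j} → T (adj H i j) → T (adj G (f i) (f j)))

Property : Set₁
Property = ∀ {n} → Graph n → Set

K_-free : ℕ → Property
K k -free G = ¬ Contains (complete k) G

Far : ℚ → Property → Property
Far ε P {n} G =
  (H : Graph n) → P H → ε ℚ.* (+ ∣E G ∣ / 1) ℚ.≤ (+ editDistance G H / 1)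

-- Elements of Fin n only index the nodes for the benefit of the definitions:
-- an algorithm never sees them.  A node sees its identifier (a bit string)
-- and addresses its incident edges by an arbitrary local port numbering.
record Network (n : ℕ) : Set where
  field
    graph  : Graph n
    ident  : Fin n → List Bool
    unique : Injective _≡_ _≡_ ident
    degree : Fin n → ℕ
    ports  : ∀ v → Fin (degree v) ↔ ∃ λ w → T (adj graph v w)

open Network public

edgeCount : ∀ {n} → Network n → ℕ
edgeCount N = ∣E graph N ∣

-- The multiplicative form of "the nodes know m up to the factor c".
Approximates : ℕ → ℕ → ℕ → Set
Approximates c m̃ m = m ≤ c * m̃ × m̃ ≤ c * m

-- An input is a network with O(log n)-bit identifiers (κ being the constant
-- in the O), together with the estimate m̃ of m that is given to all nodes.
record Input (κ c : ℕ) : Set where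
  field
    {n}         : ℕ
    network     : Network n
    ident-short : ∀ v → length (ident network v) ≤ κ * ⌈log₂ n ⌉
    m̃           : ℕ
    m̃-approx    : Approximates c m̃ (edgeCount network)

  m : ℕ
  m = edgeCount network

Message : Set
Message = List Bool

-- The first argument of rounds, coins and init is the estimate m̃; the nodes
-- are not told n.  A node's initial state depends on m̃, its degree, its
-- identifier and its private random bits.  State d is the type of local
-- states of a node of degree d; sending [] amounts to staying silent.
record Algorithm : Set₁ where
  field
    rounds  : ℕ → ℕ
    coins   : ℕ → ℕ
    State   : ℕ → Set
    init    : (m̃ d : ℕ) → List Bool → Vec Bool (coins m̃) → State d
    send    : ∀ {d} → State d → Fin d → Message
    receive : ∀ {d} → State d → (Fin d → Message) → State d
    accepts : ∀ {d} → State d → Bool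

Outcome : ℕ → ℕ → Set
Outcome n r = Vec (Vec Bool r) n

vectors : ∀ {A : Set} → List A → ∀ k → List (Vec A k)
vectors xs zero    = Vec.[] ∷ []
vectors xs (suc k) = cartesianProductWith Vec._∷_ xs (vectors xs k)

outcomes : ∀ n r → List (Outcome n r)
outcomes n r = vectors (vectors (true ∷ false ∷ []) r) n

-- Probability under independent uniform bits: there are 2 ^ (n * r) outcomes.
Pr : ∀ n r → (Outcome n r → Bool) → ℚ
Pr n r A = _/_ (+ length (filterᵇ A (outcomes n r))) (2 ^ (n * r)) {{m^n≢0 2 (n * r)}}

module Run (𝓐 : Algorithm) {κ c : ℕ} (I : Input κ c) where
  open Algorithm 𝓐
  open Input I

  Ω : Set
  Ω = Outcome n (coins m̃)

  state : Ω → ℕ → ∀ v → State (degree network v)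

  -- What v receives through port p in a round: the message that its
  -- neighbour w sends through the port of w that leads to v.
  inbox : Ω → ℕ → ∀ v → Fin (degree network v) → Message
  inbox ω t v p =
    let (w , e) = Inverse.to (ports network v) p
    in send (state ω t w)
            (Inverse.from (ports network w) (v , adj-sym (graph network) e))

  state ω zero    v = init m̃ (degree network v) (ident network v) (Vec.lookup ω v)
  state ω (suc t) v = receive (state ω t v) (inbox ω t v)

  verdict : Ω → Fin n → Bool
  verdict ω v = accepts (state ω (rounds m̃) v)

  allAccept someRejects : Ω → Bool
  allAccept   ω = all (verdict ω) (allFin n)
  someRejects ω = any (λ v → not (verdict ω v)) (allFin n)

  Prob : (Ω → Bool) → ℚ
  Prob = Pr n (coins m̃)

  -- Whatever the coin tosses, no message of the run exceeds β log n bits.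
  RespectsBandwidth : ℕ → Set
  RespectsBandwidth β =
    ∀ (ω : Ω) t → t < rounds m̃ → ∀ v (p : Fin (degree network v)) →
    length (send (state ω t v) p) ≤ β * ⌈log₂ n ⌉

-- Every edgeless graph is (vacuously) ε-far from every property, even one it
-- satisfies, so rejection is only required when the graph has an edge.
record Tests (P : Property) (ε : ℚ) (κ c : ℕ) (𝓐 : Algorithm) : Set where
  field
    complete₂₃ : ∀ (I : Input κ c) → P (graph (Input.network I)) →
                 + 2 / 3 ℚ.≤ Run.Prob 𝓐 I (Run.allAccept 𝓐 I)
    sound₂₃    : ∀ (I : Input κ c) → 0 < Input.m I →
                 Far ε P (graph (Input.network I)) →
                 + 2 / 3 ℚ.≤ Run.Prob 𝓐 I (Run.someRejects 𝓐 I)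

OneSided : Property → (κ c : ℕ) → Algorithm → Set
OneSided P κ c 𝓐 =
  ∀ (I : Input κ c) → P (graph (Input.network I)) →
  Run.Prob 𝓐 I (Run.allAccept 𝓐 I) ≡ 1ℚ

InCONGEST : (κ c : ℕ) → Algorithm → Set
InCONGEST κ c 𝓐 = ∃ λ β → ∀ (I : Input κ c) → Run.RespectsBandwidth 𝓐 I β

-- Running time O(m^(1/q)): T ≤ C · m^(1/q) reads T ^ q ≤ C ^ q · m, and the
-- constant C ^ q is renamed C.
RunsInRootTime : (q κ c : ℕ) → Algorithm → Set
RunsInRootTime q κ c 𝓐 =
  ∃ λ C → ∀ (I : Input κ c) →
  Algorithm.rounds 𝓐 (Input.m̃ I) ^ q ≤ C * Input.m I

{-# OPTIONS --safe #-}
-- A graph that is ε-far from K₅-free keeps a copy of K₅ after deleting the few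
-- edges between vertices of degree ≫ √m and any o(m) further edges, so it has
-- Ω(m) edge-disjoint copies of K₅ with at most one heavy vertex each.  Every
-- node is sampled with probability p ≈ m^(-1/3), announces this, and forwards
-- the identifiers of its sampled neighbours; a node of degree O(√m) has
-- O(m^(1/6)) of them in expectation.  A copy u,v,a,b,c of K₅ with a,b,c sampled
-- is then seen by u, because v,a,b (all light) report the missing edges.  On
-- average Ω(m p³) = Ω(1) copies have their triple a,b,c sampled, and since two
-- copies share at most one vertex, the second moment of that number is close
-- to the square of its mean.
module Submission where

open import Defs
open import Data.Bool.Base using (Bool; true; false; T; not; _xor_)
open import Data.Bool.ListAction using (all; any)
open import Data.Bool.Properties as Bool using (T-∧; T-∨; T-irrelevant)
open import Data.Fin.Base as Fin using (Fin; zero; suc; inject₁)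
open import Data.Fin.Permutation as Perm using (_⟨$⟩ʳ_)
open import Data.Fin.Properties as Fin using (_≟_; _<?_; <-cmp; any?; all?; ¬∀⟶∃¬)
open import Data.Integer.Base as ℤ using (-[1+_]; +≤+; +<+)
import Data.Integer.Properties as ℤ
open import Data.List.Base
  using (List; []; _∷_; _++_; length; filter; filterᵇ; allFin; map; drop;
         cartesianProduct; cartesianProductWith)
open import Data.List.Membership.Propositional using (_∈_; _∉_)
open import Data.List.Membership.Propositional.Properties
  using (∈-allFin; ∈-filter⁻; ∈-filter⁺; ∈-map⁻; ∈-map⁺)
open import Data.List.Properties using (drop-all; drop-drop; ≡-dec)
open import Data.List.Relation.Unary.All as All using (All)
open import Data.List.Relation.Unary.AllPairs using ([]; _∷_)
open import Data.List.Relation.Unary.Any using (here; there)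
open import Data.List.Relation.Unary.Unique.Propositional using (Unique)
open import Data.List.Relation.Unary.Unique.Propositional.Properties using (allFin⁺)
open import Data.Nat.Base
open import Data.Nat.Logarithm using (⌈log₂_⌉; ⌈log₂⌉-mono-≤)
open import Data.Nat.Properties as ℕ hiding (_≟_; _<?_; <-cmp)
open import Data.Nat.Tactic.RingSolver using (solve-∀)
open import Data.Product.Base using (Σ; ∃; _×_; _,_; proj₁; proj₂)
open import Data.Rational.Base as ℚ using (ℚ; mkℚ; 0ℚ; 1ℚ)
import Data.Rational.Properties as ℚ
open import Data.Rational.Unnormalised.Base as ℚᵘ using (mkℚᵘ; *≡*; *≤*)
import Data.Rational.Unnormalised.Properties as ℚᵘ
open import Data.Sum.Base as Sum using (_⊎_; inj₁; inj₂; [_,_]′)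
open import Data.Vec.Base as Vec using (Vec; lookup; _[_]≔_)
open import Data.Vec.Properties using (lookup∘update′)
open import Function.Base using (_∘_; case_of_)
open import Function.Bundles using (Equivalence; Injection; Inverse)
open import Function.Definitions using (Injective)
open import Function.Properties.Inverse using (↔⇒↣)
open import Level using (0ℓ)
open import Relation.Binary.Definitions using (tri<; tri≈; tri>)
open import Relation.Binary.PropositionalEquality
open import Relation.Nullary
open import Relation.Nullary.Decidable
  using (isYes; toWitness; fromWitness; dec-true; decidable-stable; _×-dec_; _⊎-dec_; T?)
open import Relation.Unary using (Pred; Decidable)

-- Finite sums

-- Sampling a copy is not enough: a speaker whose queue outlasts the run loses reports. So two
-- counts are compared. The detected copies, whose three speakers keep up, have mean at least 8/9 of
-- the mean `ℓ` of the sampled copies; the square of the sampled count has mean at most 10/9 of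
-- `ℓ * ℓ`. Together they give rejection with probability at least 16/9 - 10/9 = 2/3 in a single
-- run. The second bound forces `ℓ` to be a large constant: a copy correlates with itself and with
-- the O(√m) copies through each of its light vertices, and this excess is at most a ninth of
-- `ℓ * ℓ` once `ℓ` is about `81 * δ`, where `δ` is the constant of the degree threshold. A larger
-- `ℓ` takes a smaller scale `s`, hence a larger `δ` for the threshold `δ * s ^ 3` to leave few
-- edges between heavy vertices. The circle closes because `δ` enters that last condition squared
-- and `ℓ` only linearly. Probabilities appear as numbers of outcomes with cleared denominators, `q`
-- being the inverse of the sampling probability.

𝟙 : Bool → ℕ
𝟙 true  = 1
𝟙 false = 0

𝟙≤ : ∀ {b k} → (T b → 1 ≤ k) → 𝟙 b ≤ k
𝟙≤ {true}  h = h _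
𝟙≤ {false} h = z≤n

𝟙≤1 : ∀ b → 𝟙 b ≤ 1
𝟙≤1 b = 𝟙≤ λ _ → ≤-refl

𝟙-true : ∀ {b} → T b → 𝟙 b ≡ 1
𝟙-true {true} _ = refl

𝟙-false : ∀ {b} → ¬ T b → 𝟙 b ≡ 0
𝟙-false {true}  h = contradiction _ h
𝟙-false {false} h = refl

1≤𝟙 : ∀ {b} → T b → 1 ≤ 𝟙 b
1≤𝟙 h = ≤-reflexive (sym (𝟙-true h))

1≤𝟙⇒T : ∀ {b} → 1 ≤ 𝟙 b → T b
1≤𝟙⇒T {true} _ = _

module _ {A : Set} where

  ∑ : List A → (A → ℕ) → ℕ
  ∑ []       f = 0
  ∑ (x ∷ xs) f = f x + ∑ xs f

  infixr 8 ∑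
  syntax ∑ xs (λ x → e) = ∑[ x ∈ xs ] e

  ∑-cong : ∀ xs {f g : A → ℕ} → (∀ x → f x ≡ g x) → ∑ xs f ≡ ∑ xs g
  ∑-cong []       h = refl
  ∑-cong (x ∷ xs) h = cong₂ _+_ (h x) (∑-cong xs h)

  ∑-mono : ∀ xs {f g : A → ℕ} → (∀ x → f x ≤ g x) → ∑ xs f ≤ ∑ xs g
  ∑-mono []       h = z≤n
  ∑-mono (x ∷ xs) h = +-mono-≤ (h x) (∑-mono xs h)

  ∑-+ : ∀ xs (f g : A → ℕ) → ∑[ x ∈ xs ] (f x + g x) ≡ ∑ xs f + ∑ xs g
  ∑-+ []       f g = refl
  ∑-+ (x ∷ xs) f g = trans (cong (f x + g x +_) (∑-+ xs f g))
                           (interchange (f x) (g x) _ _)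
    where
    interchange : ∀ a b c d → a + b + (c + d) ≡ a + c + (b + d)
    interchange = solve-∀

  *-∑ : ∀ k xs (f : A → ℕ) → k * ∑ xs f ≡ ∑[ x ∈ xs ] (k * f x)
  *-∑ k []       f = *-zeroʳ k
  *-∑ k (x ∷ xs) f = trans (*-distribˡ-+ k (f x) _) (cong (k * f x +_) (*-∑ k xs f))

  ∑-* : ∀ k xs (f : A → ℕ) → ∑ xs f * k ≡ ∑[ x ∈ xs ] (f x * k)
  ∑-* k xs f = trans (*-comm _ k) (trans (*-∑ k xs f) (∑-cong xs λ x → *-comm k _))

  ∑-const : ∀ xs k → ∑ xs (λ _ → k) ≡ length xs * k
  ∑-const []       k = refl
  ∑-const (x ∷ xs) k = cong (k +_) (∑-const xs k)

  ∑-≤const : ∀ xs {f : A → ℕ} {k} → (∀ x → f x ≤ k) → ∑ xs f ≤ length xs * k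
  ∑-≤const xs {k = k} h = ≤-trans (∑-mono xs h) (≤-reflexive (∑-const xs k))

  ∑-one : ∀ xs → ∑ xs (λ _ → 1) ≡ length xs
  ∑-one xs = trans (∑-const xs 1) (*-identityʳ _)

  ≤-∑ : ∀ {xs x} (f : A → ℕ) → x ∈ xs → f x ≤ ∑ xs f
  ≤-∑ f (here refl) = m≤m+n _ _
  ≤-∑ f (there x∈)  = ≤-trans (≤-∑ f x∈) (m≤n+m _ _)

  ∑-positive : ∀ xs (f : A → ℕ) → 0 < ∑ xs f → ∃ λ x → 0 < f x
  ∑-positive (x ∷ xs) f h with f x in eq
  ... | zero  = ∑-positive xs f h
  ... | suc _ = x , ≤-trans (s≤s z≤n) (≤-reflexive (sym eq))

  ∑-filter : ∀ {P : Pred A 0ℓ} (P? : Decidable P) xs (f : A → ℕ) →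
             ∑ (filter P? xs) f ≡ ∑[ x ∈ xs ] (𝟙 (does (P? x)) * f x)
  ∑-filter P? []       f = refl
  ∑-filter P? (x ∷ xs) f with does (P? x)
  ... | true  = cong₂ _+_ (sym (+-identityʳ (f x))) (∑-filter P? xs f)
  ... | false = ∑-filter P? xs f

  length-filterᵇ : ∀ p (xs : List A) → length (filterᵇ p xs) ≡ ∑[ x ∈ xs ] 𝟙 (p x)
  length-filterᵇ p []       = refl
  length-filterᵇ p (x ∷ xs) with p x
  ... | true  = cong suc (length-filterᵇ p xs)
  ... | false = length-filterᵇ p xs

  ∑-++ : ∀ xs ys (f : A → ℕ) → ∑ (xs ++ ys) f ≡ ∑ xs f + ∑ ys f
  ∑-++ []       ys f = refl
  ∑-++ (x ∷ xs) ys f = trans (cong (f x +_) (∑-++ xs ys f)) (sym (+-assoc (f x) _ _))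

  ∑-unique : ∀ {xs} → Unique xs → (p : A → Bool) →
             (∀ {x y} → T (p x) → T (p y) → x ≡ y) → ∑[ x ∈ xs ] 𝟙 (p x) ≤ 1
  ∑-unique []       p h = z≤n
  ∑-unique {x ∷ xs} (x∉ ∷ u) p h with p x in eq
  ... | false = ∑-unique u p h
  ... | true  = s≤s (≤-reflexive (none xs x∉))
    where
    none : ∀ ys → All (x ≢_) ys → ∑[ y ∈ ys ] 𝟙 (p y) ≡ 0
    none []       _           = refl
    none (y ∷ ys) (x≢y All.∷ x≢) =
      cong₂ _+_ (𝟙-false λ py → x≢y (h (subst T (sym eq) _) py)) (none ys x≢)

∑-map : ∀ {A B : Set} (g : A → B) xs (f : B → ℕ) → ∑ (map g xs) f ≡ ∑ xs (f ∘ g)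
∑-map g []       f = refl
∑-map g (x ∷ xs) f = cong (f (g x) +_) (∑-map g xs f)

∑-comm : ∀ {A B : Set} (xs : List A) (ys : List B) (f : A → B → ℕ) →
         ∑[ x ∈ xs ] ∑[ y ∈ ys ] f x y ≡ ∑[ y ∈ ys ] ∑[ x ∈ xs ] f x y
∑-comm []       ys f = sym (trans (∑-const ys 0) (*-zeroʳ (length ys)))
∑-comm (x ∷ xs) ys f = trans (cong (∑ ys (f x) +_) (∑-comm xs ys f))
                             (sym (∑-+ ys (f x) _))

∑-cartesianProductWith : ∀ {A B C : Set} (g : A → B → C) xs ys (f : C → ℕ) →
  ∑ (cartesianProductWith g xs ys) f ≡ ∑[ x ∈ xs ] ∑[ y ∈ ys ] f (g x y)
∑-cartesianProductWith g []       ys f = refl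
∑-cartesianProductWith g (x ∷ xs) ys f =
  trans (∑-++ (map (g x) ys) _ f)
        (cong₂ _+_ (∑-map (g x) ys f) (∑-cartesianProductWith g xs ys f))

-- Sampling coordinates of a random vector

occurrences : ∀ {n} → Fin n → List (Fin n) → ℕ
occurrences v L = ∑[ w ∈ L ] 𝟙 (isYes (v ≟ w))

occurrences-∷ : ∀ {n} {v w : Fin n} L → v ≢ w → occurrences v (w ∷ L) ≡ occurrences v L
occurrences-∷ {v = v} {w} L v≢w =
  cong (_+ occurrences v L) (𝟙-false λ h → v≢w (toWitness {a? = v ≟ w} h))

occurrences≡0 : ∀ {n} {v : Fin n} L → v ∉ L → occurrences v L ≡ 0
occurrences≡0 []      _  = refl
occurrences≡0 (w ∷ L) v∉ = trans (occurrences-∷ L (v∉ ∘ here)) (occurrences≡0 L (v∉ ∘ there))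

occurrences≥1 : ∀ {n} {v : Fin n} {L} → v ∈ L → 1 ≤ occurrences v L
occurrences≥1 {v = v} v∈ =
  ≤-trans (1≤𝟙 (fromWitness {a? = v ≟ v} refl)) (≤-∑ (λ w → 𝟙 (isYes (v ≟ w))) v∈)

module Sampling {A : Set} (xs : List A) (marked : A → Bool)
                (marked-once : ∑[ x ∈ xs ] 𝟙 (marked x) ≡ 1) where

  q : ℕ
  q = length xs

  -- Independence with the denominator cleared. The factor `q` becomes a sum over a second value `y`
  -- for coordinate `v`; as `f` ignores that coordinate it may read `y`, and then only the one
  -- marked value survives in the original sum.
  independent : ∀ {n} (v : Fin n) (f : Vec A n → ℕ) → (∀ ω x → f (ω [ v ]≔ x) ≡ f ω) →
    q * ∑[ ω ∈ vectors xs n ] (𝟙 (marked (lookup ω v)) * f ω) ≡ ∑ (vectors xs n) f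
  independent {suc n} zero f inv = begin
    q * ∑[ ω ∈ vectors xs (suc n) ] (𝟙 (marked (lookup ω zero)) * f ω)
      ≡⟨ cong (q *_) (∑-cartesianProductWith Vec._∷_ xs _ _) ⟩
    q * (∑[ x ∈ xs ] ∑[ ω ∈ vectors xs n ] (𝟙 (marked x) * f (x Vec.∷ ω)))
      ≡⟨ ∑-const xs _ ⟨
    ∑[ y ∈ xs ] ∑[ x ∈ xs ] ∑[ ω ∈ vectors xs n ] (𝟙 (marked x) * f (x Vec.∷ ω))
      ≡⟨ ∑-cong xs (λ y → trans
           (∑-cong xs λ x → trans
             (∑-cong (vectors xs n) λ ω → cong (𝟙 (marked x) *_) (inv (y Vec.∷ ω) x))
             (sym (*-∑ (𝟙 (marked x)) (vectors xs n) _)))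
           (trans (sym (∑-* _ xs _)) (trans (cong (_* _) marked-once) (*-identityˡ _)))) ⟩
    ∑[ y ∈ xs ] ∑[ ω ∈ vectors xs n ] f (y Vec.∷ ω)
      ≡⟨ ∑-cartesianProductWith Vec._∷_ xs _ f ⟨
    ∑ (vectors xs (suc n)) f ∎
    where open ≡-Reasoning
  independent {suc n} (suc v) f inv = begin
    q * ∑[ ω ∈ vectors xs (suc n) ] (𝟙 (marked (lookup ω (suc v))) * f ω)
      ≡⟨ cong (q *_) (∑-cartesianProductWith Vec._∷_ xs _ _) ⟩
    q * (∑[ x ∈ xs ] ∑[ ω ∈ vectors xs n ] (𝟙 (marked (lookup ω v)) * f (x Vec.∷ ω)))
      ≡⟨ *-∑ q xs _ ⟩
    ∑[ x ∈ xs ] (q * ∑[ ω ∈ vectors xs n ] (𝟙 (marked (lookup ω v)) * f (x Vec.∷ ω)))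
      ≡⟨ ∑-cong xs (λ x → independent v (f ∘ (x Vec.∷_)) (λ ω → inv (x Vec.∷ ω))) ⟩
    ∑[ x ∈ xs ] ∑[ ω ∈ vectors xs n ] f (x Vec.∷ ω)
      ≡⟨ ∑-cartesianProductWith Vec._∷_ xs _ f ⟨
    ∑ (vectors xs (suc n)) f ∎
    where open ≡-Reasoning

  module _ {n : ℕ} where

    hits : List (Fin n) → Vec A n → ℕ
    hits []      ω = 1
    hits (v ∷ L) ω = 𝟙 (marked (lookup ω v)) * hits L ω

    hits≤1 : ∀ L ω → hits L ω ≤ 1
    hits≤1 []      ω = ≤-refl
    hits≤1 (v ∷ L) ω = *-mono-≤ (𝟙≤1 (marked (lookup ω v))) (hits≤1 L ω)

    count : List (Fin n) → ℕ
    count L = ∑ (vectors xs n) (hits L)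

    hits-invariant : ∀ {v} L → v ∉ L → ∀ ω x → hits L (ω [ v ]≔ x) ≡ hits L ω
    hits-invariant []      v∉ ω x = refl
    hits-invariant {v} (w ∷ L) v∉ ω x =
      cong₂ _*_ (cong (𝟙 ∘ marked) (lookup∘update′ (≢-sym (v∉ ∘ here)) ω x))
                (hits-invariant L (v∉ ∘ there) ω x)

    count-fresh : ∀ {v} L → v ∉ L → q * count (v ∷ L) ≡ count L
    count-fresh {v} L v∉L = independent v (hits L) (hits-invariant L v∉L)

    hits-tail : ∀ v L ω → hits (v ∷ L) ω ≤ hits L ω
    hits-tail v L ω = ≤-trans (*-monoˡ-≤ (hits L ω) (𝟙≤1 (marked (lookup ω v))))
                              (≤-reflexive (*-identityˡ (hits L ω)))

    -- A fresh vertex costs a factor `q`, a vertex already in `L` costs nothing. Covering both cases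
    -- by one factor that is affine in `occurrences v L` allows the bound to be multiplied out and
    -- summed over cliques.
    count-∷ : ∀ v L → q * count (v ∷ L) ≤ (1 + occurrences v L * q) * count L
    count-∷ v L with v ∈? L
      where open import Data.List.Membership.DecPropositional (_≟_ {n}) using (_∈?_)
    ... | no v∉L = ≤-reflexive (begin
      q * count (v ∷ L)                     ≡⟨ count-fresh L v∉L ⟩
      count L                               ≡⟨ *-identityˡ _ ⟨
      1 * count L                           ≡⟨ cong (λ o → (1 + o * q) * count L) (occurrences≡0 L v∉L) ⟨
      (1 + occurrences v L * q) * count L   ∎)
      where open ≡-Reasoning
    ... | yes v∈L = begin
      q * count (v ∷ L)                     ≤⟨ *-mono-≤ (m≤n+m q 1) (∑-mono (vectors xs n) λ ω →
                                                 hits-tail v L ω) ⟩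
      (1 + q) * count L                     ≡⟨ cong (λ k → (1 + k) * count L) (*-identityˡ q) ⟨
      (1 + 1 * q) * count L                 ≤⟨ *-monoˡ-≤ (count L) (s≤s (*-monoˡ-≤ q (occurrences≥1 v∈L))) ⟩
      (1 + occurrences v L * q) * count L   ∎
      where open ≤-Reasoning

    count-triple : ∀ {a b c} → a ≢ b → a ≢ c → b ≢ c →
      q * (q * (q * count (a ∷ b ∷ c ∷ []))) ≡ count []
    count-triple {a} {b} {c} a≢b a≢c b≢c =
      trans (cong (λ k → q * (q * k)) (count-fresh (b ∷ c ∷ [])
              λ { (here e) → a≢b e ; (there (here e)) → a≢c e }))
      (trans (cong (q *_) (count-fresh (c ∷ []) λ { (here e) → b≢c e }))
             (count-fresh [] λ ()))

    count-∷³ : ∀ {a b c} L → a ≢ b → a ≢ c → b ≢ c →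
      q * (q * (q * count (a ∷ b ∷ c ∷ L))) ≤
      (1 + occurrences a L * q) * (1 + occurrences b L * q) * (1 + occurrences c L * q) * count L
    count-∷³ {a} {b} {c} L a≢b a≢c b≢c = begin
      q * (q * (q * count (a ∷ b ∷ c ∷ L)))
        ≤⟨ *-monoʳ-≤ q (*-monoʳ-≤ q (count-∷ a (b ∷ c ∷ L))) ⟩
      q * (q * (f (occurrences a (b ∷ c ∷ L)) * count (b ∷ c ∷ L)))
        ≡⟨ cong (λ o → q * (q * (f o * count (b ∷ c ∷ L))))
             (trans (occurrences-∷ (c ∷ L) a≢b) (occurrences-∷ L a≢c)) ⟩
      q * (q * (f α * count (b ∷ c ∷ L)))
        ≡⟨ move q (f α) (count (b ∷ c ∷ L)) ⟩
      f α * (q * (q * count (b ∷ c ∷ L)))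
        ≤⟨ *-monoʳ-≤ (f α) (*-monoʳ-≤ q (count-∷ b (c ∷ L))) ⟩
      f α * (q * (f (occurrences b (c ∷ L)) * count (c ∷ L)))
        ≡⟨ cong (λ o → f α * (q * (f o * count (c ∷ L)))) (occurrences-∷ L b≢c) ⟩
      f α * (q * (f β * count (c ∷ L)))
        ≡⟨ move′ q (f α) (f β) (count (c ∷ L)) ⟩
      f α * f β * (q * count (c ∷ L))
        ≤⟨ *-monoʳ-≤ (f α * f β) (count-∷ c L) ⟩
      f α * f β * (f (occurrences c L) * count L)
        ≡⟨ *-assoc (f α * f β) (f (occurrences c L)) (count L) ⟨
      f α * f β * f (occurrences c L) * count L ∎
      where
      open ≤-Reasoning
      f : ℕ → ℕ
      f o = 1 + o * q
      α β : ℕ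
      α = occurrences a L
      β = occurrences b L
      move : ∀ q x y → q * (q * (x * y)) ≡ x * (q * (q * y))
      move = solve-∀
      move′ : ∀ q x z y → x * (q * (z * y)) ≡ x * z * (q * y)
      move′ = solve-∀

-- Counting edges

∑-allFin-δ : ∀ {n} (w : Fin n) → ∑[ v ∈ allFin n ] 𝟙 (isYes (w ≟ v)) ≤ 1
∑-allFin-δ {n} w = ∑-unique (allFin⁺ n) (λ v → isYes (w ≟ v)) λ {x} {y} h k →
  trans (sym (toWitness {a? = w ≟ x} h)) (toWitness {a? = w ≟ y} k)

∑-pairs : ∀ {n} (f : Fin n × Fin n → ℕ) →
  ∑ (pairs n) f ≡ ∑[ u ∈ allFin n ] ∑[ v ∈ allFin n ] (𝟙 (does (u <? v)) * f (u , v))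
∑-pairs {n} f =
  trans (∑-filter (λ (u , v) → u <? v) (cartesianProduct (allFin n) (allFin n)) f)
        (∑-cartesianProductWith _,_ (allFin n) (allFin n) _)

deg : ∀ {n} → Graph n → Fin n → ℕ
deg {n} G v = ∑[ w ∈ allFin n ] 𝟙 (adj G v w)

adj⇒≢ : ∀ {n} (G : Graph n) {u v} → T (adj G u v) → u ≢ v
adj⇒≢ G uv refl = adj-irrefl G uv

∑-deg≤2∣E∣ : ∀ {n} (G : Graph n) → ∑ (allFin n) (deg G) ≤ 2 * ∣E G ∣
∑-deg≤2∣E∣ {n} G = begin
  ∑[ u ∈ V ] ∑[ v ∈ V ] 𝟙 (adj G u v)
    ≤⟨ ∑-mono V (λ u → ∑-mono V (λ v → 𝟙≤ (oriented u v))) ⟩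
  ∑[ u ∈ V ] ∑[ v ∈ V ] (up u v + up v u)
    ≡⟨ ∑-cong V (λ u → ∑-+ V (up u) (λ v → up v u)) ⟩
  ∑[ u ∈ V ] (∑[ v ∈ V ] up u v + ∑[ v ∈ V ] up v u)
    ≡⟨ ∑-+ V _ _ ⟩
  ∑[ u ∈ V ] ∑[ v ∈ V ] up u v + ∑[ u ∈ V ] ∑[ v ∈ V ] up v u
    ≡⟨ cong (∑[ u ∈ V ] ∑[ v ∈ V ] up u v +_) (∑-comm V V (λ u v → up v u)) ⟩
  ∑[ u ∈ V ] ∑[ v ∈ V ] up u v + ∑[ v ∈ V ] ∑[ u ∈ V ] up v u
    ≡⟨ cong₂ _+_ E≡ (trans (+-identityʳ _) E≡) ⟨
  2 * ∣E G ∣ ∎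
  where
  open ≤-Reasoning
  V : List (Fin n)
  V = allFin n
  up : Fin n → Fin n → ℕ
  up u v = 𝟙 (does (u <? v)) * 𝟙 (adj G u v)
  E≡ : ∣E G ∣ ≡ ∑[ u ∈ V ] ∑[ v ∈ V ] up u v
  E≡ = trans (length-filterᵇ _ (pairs n)) (∑-pairs {n} (λ (u , v) → 𝟙 (adj G u v)))
  up≥1 : ∀ {u v} → u Fin.< v → T (adj G u v) → 1 ≤ up u v
  up≥1 {u} {v} u<v uv rewrite dec-true (u <? v) u<v = ≤-trans (1≤𝟙 uv) (m≤m+n _ 0)
  oriented : ∀ u v → T (adj G u v) → 1 ≤ up u v + up v u
  oriented u v uv with <-cmp u v
  ... | tri< u<v _ _ = ≤-trans (up≥1 u<v uv) (m≤m+n _ _)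
  ... | tri≈ _ u≡v _ = contradiction u≡v (adj⇒≢ G uv)
  ... | tri> _ _ v<u = ≤-trans (up≥1 v<u (adj-sym G uv)) (m≤n+m _ _)

-- Ordered pairs may count an edit twice, but the double sum then factors over its two endpoints.
editDistance≤ : ∀ {n} (G H : Graph n) →
  editDistance G H ≤ ∑[ u ∈ allFin n ] ∑[ v ∈ allFin n ] 𝟙 (adj G u v xor adj H u v)
editDistance≤ {n} G H = begin
  editDistance G H
    ≡⟨ trans (length-filterᵇ _ (pairs n)) (∑-pairs {n} (λ (u , v) → 𝟙 (adj G u v xor adj H u v))) ⟩
  ∑[ u ∈ allFin n ] ∑[ v ∈ allFin n ] (𝟙 (does (u <? v)) * 𝟙 (adj G u v xor adj H u v))
    ≤⟨ ∑-mono (allFin n) (λ u → ∑-mono (allFin n) λ v →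
         ≤-trans (*-monoˡ-≤ (𝟙 (adj G u v xor adj H u v)) (𝟙≤1 (does (u <? v)))) (≤-reflexive (*-identityˡ _))) ⟩
  ∑[ u ∈ allFin n ] ∑[ v ∈ allFin n ] 𝟙 (adj G u v xor adj H u v) ∎
  where open ≤-Reasoning

-- Packing edge-disjoint cliques

module Packings {n : ℕ} (G : Graph n) (D : ℕ) where

  private
    V : List (Fin n)
    V = allFin n

  Light : Fin n → Set
  Light v = deg G v ≤ D

  -- Vertex 0 is the one that may be heavy.
  record LightClique : Set where
    field
      vertex   : Fin 5 → Fin n
      adjacent : ∀ {i j} → i ≢ j → T (adj G (vertex i) (vertex j))
      light    : ∀ i → Light (vertex (suc i))

    distinct : ∀ {i j} → i ≢ j → vertex i ≢ vertex j
    distinct i≢j = adj⇒≢ G (adjacent i≢j)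

  open LightClique public

  -- The normal forms of these searches over Fin 5 are huge.
  abstract
    meets : LightClique → Fin n → Bool
    meets K u = isYes (any? λ i → vertex K i ≟ u)

    meets-vertex : ∀ K {u} i → vertex K i ≡ u → T (meets K u)
    meets-vertex K {u} i e = fromWitness {a? = any? λ i → vertex K i ≟ u} (i , e)

    meets⇒vertex : ∀ K {u} → T (meets K u) → ∃ λ i → vertex K i ≡ u
    meets⇒vertex K {u} = toWitness {a? = any? λ i → vertex K i ≟ u}

    private
      covers? : ∀ K u v → Dec (∃ λ i → ∃ λ j → i ≢ j × vertex K i ≡ u × vertex K j ≡ v)
      covers? K u v = any? λ i → any? λ j → ¬? (i ≟ j) ×-dec (vertex K i ≟ u ×-dec vertex K j ≟ v)

    covers : LightClique → Fin n → Fin n → Bool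
    covers K u v = isYes (covers? K u v)

    covers-edge : ∀ K {u v} i j → i ≢ j → vertex K i ≡ u → vertex K j ≡ v → T (covers K u v)
    covers-edge K {u} {v} i j i≢j eu ev = fromWitness {a? = covers? K u v} (i , j , i≢j , eu , ev)

    covers⇒edge : ∀ K {u v} → T (covers K u v) → ∃ λ i → ∃ λ j → i ≢ j × vertex K i ≡ u × vertex K j ≡ v
    covers⇒edge K {u} {v} = toWitness {a? = covers? K u v}

  covers-sym : ∀ K {u v} → T (covers K u v) → T (covers K v u)
  covers-sym K c = let (i , j , i≢j , eu , ev) = covers⇒edge K c in covers-edge K j i (≢-sym i≢j) ev eu

  multiplicity : List LightClique → Fin n → Fin n → ℕ
  multiplicity P u v = ∑[ K ∈ P ] 𝟙 (covers K u v)

  multiplicity-sym : ∀ P u v → multiplicity P u v ≤ multiplicity P v u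
  multiplicity-sym P u v = ∑-mono P λ K → 𝟙≤ (1≤𝟙 ∘ covers-sym K)

  -- Edge-disjointness. Bounding by the indicator of adjacency instead of 1 makes row sums of
  -- `multiplicity` bounded by degrees.
  IsPacking : List LightClique → Set
  IsPacking P = ∀ u v → multiplicity P u v ≤ 𝟙 (adj G u v)

  heavy? : Fin n → Bool
  heavy? v = isYes (D ℕ.<? deg G v)

  #heavy : ℕ
  #heavy = ∑[ v ∈ V ] 𝟙 (heavy? v)

  heavy⊎light : ∀ v → T (heavy? v) ⊎ Light v
  heavy⊎light v with D ℕ.<? deg G v
  ... | yes _  = inj₁ _
  ... | no D≮  = inj₂ (≮⇒≥ D≮)

  #heavy*D≤ : #heavy * D ≤ 2 * ∣E G ∣
  #heavy*D≤ = begin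
    #heavy * D                       ≡⟨ ∑-* D V _ ⟩
    ∑[ v ∈ V ] (𝟙 (heavy? v) * D)    ≤⟨ ∑-mono V bound ⟩
    ∑ V (deg G)                      ≤⟨ ∑-deg≤2∣E∣ G ⟩
    2 * ∣E G ∣                       ∎
    where
    open ≤-Reasoning
    bound : ∀ v → 𝟙 (heavy? v) * D ≤ deg G v
    bound v with D ℕ.<? deg G v
    ... | yes D<d = ≤-trans (≤-reflexive (*-identityˡ D)) (<⇒≤ D<d)
    ... | no _    = z≤n

  private
    Kept : List LightClique → Fin n → Fin n → Set
    Kept P u v = T (adj G u v) × (Light u ⊎ Light v) × multiplicity P u v ≡ 0

    kept? : ∀ P u v → Dec (Kept P u v)
    kept? P u v = T? (adj G u v) ×-dec
      ((deg G u ≤? D ⊎-dec deg G v ≤? D) ×-dec multiplicity P u v ℕ.≟ 0)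

    kept-sym : ∀ P {u v} → Kept P u v → Kept P v u
    kept-sym P {u} {v} (uv , l , none) =
      adj-sym G uv , Sum.swap l , n≤0⇒n≡0 (≤-trans (multiplicity-sym P v u) (≤-reflexive none))

  -- A K₅ in this graph has at most one heavy vertex and shares no edge with `P`, so it can be added
  -- to the packing.
  prune : List LightClique → Graph n
  prune P = record
    { adj        = λ u v → isYes (kept? P u v)
    ; adj-sym    = λ {u} {v} h →
        fromWitness {a? = kept? P v u} (kept-sym P (toWitness {a? = kept? P u v} h))
    ; adj-irrefl = λ {v} h → adj-irrefl G (proj₁ (toWitness {a? = kept? P v v} h))
    }

  private
    ∑-meets : ∀ K → ∑[ u ∈ V ] 𝟙 (meets K u) ≤ 5
    ∑-meets K = begin
      ∑[ u ∈ V ] 𝟙 (meets K u)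
        ≤⟨ ∑-mono V (λ u → 𝟙≤ λ m → let (i , e) = meets⇒vertex K m in
             ≤-trans (1≤𝟙 (fromWitness {a? = vertex K i ≟ u} e))
                     (≤-∑ (λ i → 𝟙 (isYes (vertex K i ≟ u))) (∈-allFin i))) ⟩
      ∑[ u ∈ V ] ∑[ i ∈ allFin 5 ] 𝟙 (isYes (vertex K i ≟ u))
        ≡⟨ ∑-comm V (allFin 5) (λ u i → 𝟙 (isYes (vertex K i ≟ u))) ⟩
      ∑[ i ∈ allFin 5 ] ∑[ u ∈ V ] 𝟙 (isYes (vertex K i ≟ u))
        ≤⟨ ∑-≤const (allFin 5) (λ i → ∑-allFin-δ (vertex K i)) ⟩
      5 ∎
      where open ≤-Reasoning

    ∑∑-* : ∀ (f g : Fin n → ℕ) → ∑[ u ∈ V ] ∑[ v ∈ V ] (f u * g v) ≡ ∑ V f * ∑ V g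
    ∑∑-* f g = trans (∑-cong V λ u → sym (*-∑ (f u) V g)) (sym (∑-* (∑ V g) V f))

    ∑∑-covers : ∀ K → ∑[ u ∈ V ] ∑[ v ∈ V ] 𝟙 (covers K u v) ≤ 25
    ∑∑-covers K = begin
      ∑[ u ∈ V ] ∑[ v ∈ V ] 𝟙 (covers K u v)
        ≤⟨ ∑-mono V (λ u → ∑-mono V λ v → 𝟙≤ λ c →
             let (i , j , _ , eu , ev) = covers⇒edge K c in
             *-mono-≤ (1≤𝟙 (meets-vertex K i eu)) (1≤𝟙 (meets-vertex K j ev))) ⟩
      ∑[ u ∈ V ] ∑[ v ∈ V ] (𝟙 (meets K u) * 𝟙 (meets K v))
        ≡⟨ ∑∑-* _ _ ⟩
      (∑[ u ∈ V ] 𝟙 (meets K u)) * (∑[ u ∈ V ] 𝟙 (meets K u))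
        ≤⟨ *-mono-≤ (∑-meets K) (∑-meets K) ⟩
      25 ∎
      where open ≤-Reasoning

  editDistance-prune : ∀ P → editDistance G (prune P) ≤ #heavy * #heavy + length P * 25
  editDistance-prune P = begin
    editDistance G (prune P)
      ≤⟨ editDistance≤ G (prune P) ⟩
    ∑[ u ∈ V ] ∑[ v ∈ V ] 𝟙 (adj G u v xor adj (prune P) u v)
      ≤⟨ ∑-mono V (λ u → ∑-mono V (removed u)) ⟩
    ∑[ u ∈ V ] ∑[ v ∈ V ] (𝟙 (heavy? u) * 𝟙 (heavy? v) + multiplicity P u v)
      ≡⟨ trans (∑-cong V λ u → ∑-+ V _ _) (∑-+ V _ _) ⟩
    ∑[ u ∈ V ] ∑[ v ∈ V ] (𝟙 (heavy? u) * 𝟙 (heavy? v)) + ∑[ u ∈ V ] ∑[ v ∈ V ] multiplicity P u v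
      ≡⟨ cong₂ _+_ (∑∑-* _ _) (trans (∑-cong V λ u → ∑-comm V P _) (∑-comm V P _)) ⟩
    #heavy * #heavy + ∑[ K ∈ P ] ∑[ u ∈ V ] ∑[ v ∈ V ] 𝟙 (covers K u v)
      ≤⟨ +-monoʳ-≤ (#heavy * #heavy) (∑-≤const P ∑∑-covers) ⟩
    #heavy * #heavy + length P * 25 ∎
    where
    open ≤-Reasoning
    removed : ∀ u v → 𝟙 (adj G u v xor adj (prune P) u v) ≤ 𝟙 (heavy? u) * 𝟙 (heavy? v) + multiplicity P u v
    removed u v with adj G u v in uv | kept? P u v
    ... | false | no _         = z≤n
    ... | false | yes (() , _)
    ... | true  | yes _        = z≤n
    ... | true  | no ¬kept with heavy⊎light u | heavy⊎light v | multiplicity P u v in mult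
    ...   | inj₁ hu | inj₁ hv | _     = ≤-trans (*-mono-≤ (1≤𝟙 hu) (1≤𝟙 hv)) (m≤m+n _ _)
    ...   | _       | _       | suc _ = ≤-trans (s≤s z≤n) (m≤n+m _ _)
    ...   | inj₂ lu | _       | zero  = contradiction (_ , inj₁ lu , refl) ¬kept
    ...   | inj₁ _  | inj₂ lv | zero  = contradiction (_ , inj₂ lv , refl) ¬kept

  private
    extend : ∀ P → IsPacking P → Contains (complete 5) (prune P) →
             ∃ λ K → IsPacking (K ∷ P)
    extend P packing (f , f-injective , f-adj) = K , packing′
      where
      kept : ∀ {i j} → i ≢ j → Kept P (f i) (f j)
      kept {i} {j} i≢j = toWitness {a? = kept? P (f i) (f j)} (f-adj (fromWitness {a? = ¬? (i ≟ j)} i≢j))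

      heavy-unique : ∀ {i j} → i ≢ j → T (heavy? (f i)) → Light (f j)
      heavy-unique {i} {j} i≢j hi with proj₁ (proj₂ (kept i≢j))
      ... | inj₁ li = contradiction (toWitness {a? = D ℕ.<? deg G (f i)} hi) (≤⇒≯ li)
      ... | inj₂ lj = lj

      all-light-but : ∃ λ i → ∀ j → i ≢ j → Light (f j)
      all-light-but with any? (λ i → T? (heavy? (f i)))
      ... | yes (i , hi) = i , λ j i≢j → heavy-unique i≢j hi
      -- All five vertices are light, so any index would serve as the exception.
      ... | no none      = zero , λ j _ → case heavy⊎light (f j) of λ
        { (inj₁ hj) → contradiction (j , hj) none ; (inj₂ lj) → lj }

      i₀ : Fin 5
      i₀ = proj₁ all-light-but

      -- Moves the vertex that may be heavy to position 0.
      π : Perm.Permutation 5 5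
      π = Perm.transpose zero i₀

      π-injective : Injective _≡_ _≡_ (π ⟨$⟩ʳ_)
      π-injective = Injection.injective (↔⇒↣ π)

      K : LightClique
      K = record
        { vertex   = f ∘ (π ⟨$⟩ʳ_)
        ; adjacent = λ i≢j → proj₁ (kept (i≢j ∘ π-injective))
        ; light    = λ i → proj₂ all-light-but (π ⟨$⟩ʳ suc i) λ e →
            case π-injective {zero} {suc i} e of λ ()
        }

      packing′ : IsPacking (K ∷ P)
      packing′ u v with covers K u v in c
      ... | false = packing u v
      ... | true  with covers⇒edge K {u} {v} (subst T (sym c) _)
      ...   | i , j , i≢j , refl , refl =
        let (uv , _ , none) = kept (i≢j ∘ π-injective) in
        ≤-trans (≤-reflexive (cong suc none)) (1≤𝟙 uv)

  -- Greedy packing: while `prune P` is too close to `G` to be K₅-free, another clique fits. Farness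
  -- only refutes K₅-freeness, hence the double negation. The constant 50 is twice the 25 ordered
  -- pairs charged to a clique. The `pred` appears because the last clique is found when `pred k`
  -- are packed; for `k` equal to 1 a single edge in `G` is enough.
  packing-exists : ∀ e →
    (∀ (H : Graph n) → K 5 -free H → ∣E G ∣ ≤ e * editDistance G H) →
    2 * (e * (#heavy * #heavy)) ≤ ∣E G ∣ →
    ∀ k → 50 * e * pred k < ∣E G ∣ →
    ¬ ¬ (Σ (List LightClique) λ P → length P ≡ k × IsPacking P)
  packing-exists e far few zero    _     none = none ([] , refl , λ u v → z≤n)
  packing-exists e far few (suc k) small none =
    packing-exists e far few k (≤-<-trans (*-monoʳ-≤ (50 * e) pred[n]≤n) small) λ (P , ∣P∣≡k , packing) →
      <⇒≱ (close P ∣P∣≡k) (far (prune P) λ contains →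
        let (K , packing′) = extend P packing contains in none (K ∷ P , cong suc ∣P∣≡k , packing′))
    where
    close : ∀ P → length P ≡ k → e * editDistance G (prune P) < ∣E G ∣
    close P refl = *-cancelˡ-< 2 _ _ (begin-strict
      2 * (e * editDistance G (prune P))
        ≤⟨ *-monoʳ-≤ 2 (*-monoʳ-≤ e (editDistance-prune P)) ⟩
      2 * (e * (#heavy * #heavy + k * 25))
        ≡⟨ expand e #heavy k ⟩
      2 * (e * (#heavy * #heavy)) + 50 * e * k
        <⟨ +-mono-≤-< few small ⟩
      ∣E G ∣ + ∣E G ∣
        ≡⟨ cong (∣E G ∣ +_) (+-identityʳ _) ⟨
      2 * ∣E G ∣ ∎)
      where
      open ≤-Reasoning
      expand : ∀ e h k → 2 * (e * (h * h + k * 25)) ≡ 2 * (e * (h * h)) + 50 * e * k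
      expand = solve-∀

  module _ {P} (packing : IsPacking P) where

    -- Each clique counted owns the edge from `w` to its vertex 0, and edge-disjointness makes these
    -- edges distinct.
    ∑-vertex≤deg : ∀ i w → ∑[ K ∈ P ] 𝟙 (isYes (vertex K (suc i) ≟ w)) ≤ deg G w
    ∑-vertex≤deg i w = begin
      ∑[ K ∈ P ] 𝟙 (isYes (vertex K (suc i) ≟ w))
        ≤⟨ ∑-mono P (λ K → 𝟙≤ λ m →
             ≤-trans (1≤𝟙 (covers-edge K (suc i) zero (λ ()) (toWitness {a? = vertex K (suc i) ≟ w} m) refl))
                     (≤-∑ (λ x → 𝟙 (covers K w x)) (∈-allFin (vertex K zero)))) ⟩
      ∑[ K ∈ P ] ∑[ x ∈ V ] 𝟙 (covers K w x)
        ≡⟨ ∑-comm P V _ ⟩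
      ∑[ x ∈ V ] multiplicity P w x
        ≤⟨ ∑-mono V (packing w) ⟩
      deg G w ∎
      where open ≤-Reasoning

    -- Two cliques counted here would share the edge between `w` and `x`.
    ∑-pair≤1 : ∀ {i j} → i ≢ j → ∀ w x →
      ∑[ K ∈ P ] (𝟙 (isYes (vertex K i ≟ w)) * 𝟙 (isYes (vertex K j ≟ x))) ≤ 1
    ∑-pair≤1 {i} {j} i≢j w x = begin
      ∑[ K ∈ P ] (𝟙 (isYes (vertex K i ≟ w)) * 𝟙 (isYes (vertex K j ≟ x)))
        ≤⟨ ∑-mono P both ⟩
      multiplicity P w x
        ≤⟨ packing w x ⟩
      𝟙 (adj G w x)
        ≤⟨ 𝟙≤1 _ ⟩
      1 ∎
      where
      open ≤-Reasoning
      both : ∀ K → 𝟙 (isYes (vertex K i ≟ w)) * 𝟙 (isYes (vertex K j ≟ x)) ≤ 𝟙 (covers K w x)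
      both K with vertex K i ≟ w | vertex K j ≟ x
      ... | no _  | _     = z≤n
      ... | yes _ | no _  = z≤n
      ... | yes e | yes f = 1≤𝟙 (covers-edge K i j i≢j e f)

-- Forwarding the sampled neighbours

-- A node first sends its card, that is, its identifier preceded by whether it
-- is sampled, and then forwards the cards of its sampled neighbours.
data NodeState (d : ℕ) : Set where
  fresh   : (card : Message) → NodeState d
  running : (cards : Fin d → Message) (queue : List Message) (heard : Fin d → List Message) → NodeState d

unanimous : ∀ {r} → Vec Bool r → Bool
unanimous Vec.[]          = true
unanimous (true Vec.∷ bs)  = unanimous bs
unanimous (false Vec.∷ bs) = false

sampled : Message → Bool
sampled []      = false
sampled (b ∷ _) = b

next : List Message → Message
next []      = []
next (x ∷ _) = x

next-drop : ∀ t Q → next (drop t Q) ≡ [] ⊎ next (drop t Q) ∈ Q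
next-drop zero    []      = inj₁ refl
next-drop zero    (x ∷ Q) = inj₂ (here refl)
next-drop (suc t) []      = inj₁ refl
next-drop (suc t) (x ∷ Q) = Sum.map₂ there (next-drop t Q)

drop-1-drop : ∀ t (Q : List Message) → drop 1 (drop t Q) ≡ drop (suc t) Q
drop-1-drop t Q = trans (drop-drop t 1 Q) (cong (λ s → drop s Q) (+-comm t 1))

module _ {d : ℕ} (cards : Fin d → Message) where

  sampledCards : List Message
  sampledCards = filterᵇ sampled (map cards (allFin d))

  module _ (heard : Fin d → List Message) where

    Reports : Fin d → Fin d → Set
    Reports p p′ = cards p′ ∈ heard p

    -- With the node itself, the neighbours at the four ports form a K₅.
    CliqueSeen : Set
    CliqueSeen = ∃ λ v → ∃ λ a → ∃ λ b → ∃ λ c →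
      Reports v a × Reports v b × Reports v c × Reports a b × Reports a c × Reports b c

    cliqueSeen? : Dec CliqueSeen
    cliqueSeen? = any? λ v → any? λ a → any? λ b → any? λ c →
      reports? v a ×-dec reports? v b ×-dec reports? v c ×-dec
      reports? a b ×-dec reports? a c ×-dec reports? b c
      where
      open import Data.List.Membership.DecPropositional (≡-dec Bool._≟_) using (_∈?_)
      reports? : ∀ p p′ → Dec (Reports p p′)
      reports? p p′ = cards p′ ∈? heard p

-- Queues are simply cut off when the run ends. This loses reports, and a lost report can only
-- prevent a rejection, so the error stays one-sided.
protocol : (rounds coins : ℕ → ℕ) → Algorithm
protocol rounds coins = record
  { rounds  = rounds
  ; coins   = coins
  ; State   = NodeState
  ; init    = λ _ _ ident bits → fresh (unanimous bits ∷ ident)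
  ; send    = λ { (fresh card) _ → card ; (running _ queue _) _ → next queue }
  ; receive = λ
      { (fresh _)                   inbox → running inbox (sampledCards inbox) (λ _ → [])
      ; (running cards queue heard) inbox → running cards (drop 1 queue) (λ p → inbox p ∷ heard p)
      }
  ; accepts = λ
      { (fresh _)               → true
      ; (running cards _ heard) → not (isYes (cliqueSeen? cards heard))
      }
  }

-- Runs of the protocol: bandwidth, one-sided error, detection

module Protocol (rounds coins : ℕ → ℕ) {κ c : ℕ} (I : Input κ c) where

  open Input I using (n; network; ident-short; m̃)
  open Run (protocol rounds coins) I public

  G : Graph n
  G = graph network

  neighbour : ∀ v → Fin (degree network v) → Fin n
  neighbour v p = proj₁ (Inverse.to (ports network v) p)

  neighbour-adj : ∀ v p → T (adj G v (neighbour v p))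
  neighbour-adj v p = proj₂ (Inverse.to (ports network v) p)

  port : ∀ {v w} → T (adj G v w) → ∃ λ p → neighbour v p ≡ w
  port {v} {w} vw = Inverse.from (ports network v) (w , vw) ,
                    cong proj₁ (Inverse.strictlyInverseˡ (ports network v) (w , vw))

  neighbour-injective : ∀ v → Injective _≡_ _≡_ (neighbour v)
  neighbour-injective v {p} {p′} e = Injection.injective (↔⇒↣ (ports network v)) (pair≡ e)
    where
    pair≡ : ∀ {x y : ∃ λ w → T (adj G v w)} → proj₁ x ≡ proj₁ y → x ≡ y
    pair≡ {w , e} {_ , e′} refl = cong (w ,_) (T-irrelevant e e′)

  isSampled : Ω → Fin n → Bool
  isSampled ω v = unanimous (lookup ω v)

  card : Ω → Fin n → Message
  card ω v = isSampled ω v ∷ ident network v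

  card-injective : ∀ ω {v w} → card ω v ≡ card ω w → v ≡ w
  card-injective ω e = unique network (cong (drop 1) e)

  cardsAt : Ω → ∀ v → Fin (degree network v) → Message
  cardsAt ω v p = card ω (neighbour v p)

  queue₀ : Ω → Fin n → List Message
  queue₀ ω v = sampledCards (cardsAt ω v)

  heardAt : Ω → ℕ → ∀ v → Fin (degree network v) → List Message
  heardAt ω zero    v p = []
  heardAt ω (suc t) v p = next (drop t (queue₀ ω (neighbour v p))) ∷ heardAt ω t v p

  -- The first round exchanges the cards, so after `suc t` rounds each node has forwarded from its
  -- queue for `t` rounds. The reports, being a function of the port, are compared pointwise.
  state-suc : ∀ ω t v → ∃ λ heard →
    state ω (suc t) v ≡ running (cardsAt ω v) (drop t (queue₀ ω v)) heard ×
    (∀ p → heard p ≡ heardAt ω t v p)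
  state-suc ω zero    v = _ , refl , λ p → refl
  state-suc ω (suc t) v with state ω (suc t) v | state-suc ω t v
  ... | _ | heard , refl , heard≡ =
    (λ p → inbox ω (suc t) v p ∷ heard p)
      , cong (λ Q → running (cardsAt ω v) Q (λ p → inbox ω (suc t) v p ∷ heard p))
             (drop-1-drop t (queue₀ ω v))
      , λ p → cong₂ _∷_ (received p) (heard≡ p)
    where
    received : ∀ p → inbox ω (suc t) v p ≡ next (drop t (queue₀ ω (neighbour v p)))
    received p with state ω (suc t) (neighbour v p) | state-suc ω t (neighbour v p)
    ... | _ | _ , refl , _ = refl

  ∈-queue₀⁻ : ∀ {ω v x} → x ∈ queue₀ ω v → ∃ λ w → T (adj G v w) × x ≡ card ω w
  ∈-queue₀⁻ {ω} {v} x∈ =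
    let (p , _ , x≡) = ∈-map⁻ (cardsAt ω v) (proj₁ (∈-filter⁻ (T? ∘ sampled) {xs = map (cardsAt ω v) (allFin _)} x∈))
    in neighbour v p , neighbour-adj v p , x≡

  ∈-queue₀⁺ : ∀ {ω v w} → T (adj G v w) → T (isSampled ω w) → card ω w ∈ queue₀ ω v
  ∈-queue₀⁺ {ω} {v} vw s with port vw
  ... | p , refl = ∈-filter⁺ (T? ∘ sampled) (∈-map⁺ (cardsAt ω v) (∈-allFin p)) s

  ∈-heardAt⁻ : ∀ {ω x} t {v p} → x ∈ heardAt ω t v p → x ≡ [] ⊎ x ∈ queue₀ ω (neighbour v p)
  ∈-heardAt⁻ {ω} (suc t) {v} {p} (here refl) = next-drop t (queue₀ ω (neighbour v p))
  ∈-heardAt⁻ (suc t) (there x∈)  = ∈-heardAt⁻ t x∈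

  heard-or-queued : ∀ {ω x} t {v p} → x ∈ queue₀ ω (neighbour v p) →
    x ∈ heardAt ω t v p ⊎ x ∈ drop t (queue₀ ω (neighbour v p))
  heard-or-queued zero x∈ = inj₂ x∈
  heard-or-queued {ω} {x} (suc t) {v} {p} x∈ with heard-or-queued t x∈
  ... | inj₁ x∈heard = inj₁ (there x∈heard)
  ... | inj₂ x∈drop  = Sum.map (λ e → here e) (subst (x ∈_) (drop-1-drop t Q)) (split (drop t Q) x∈drop)
    where
    Q : List Message
    Q = queue₀ ω (neighbour v p)
    split : ∀ Q → x ∈ Q → x ≡ next Q ⊎ x ∈ drop 1 Q
    split (_ ∷ _) (here e)  = inj₁ e
    split (_ ∷ _) (there i) = inj₂ i

  ∈-heardAt⁺ : ∀ {ω v p w} t → T (adj G (neighbour v p) w) → T (isSampled ω w) →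
    length (queue₀ ω (neighbour v p)) ≤ t → card ω w ∈ heardAt ω t v p
  ∈-heardAt⁺ {ω} {v} {p} {w} t vw s fits with heard-or-queued {ω} t {v} {p} (∈-queue₀⁺ {ω} vw s)
  ... | inj₁ heard  = heard
  ... | inj₂ queued with subst (card ω w ∈_) (drop-all t _ fits) queued
  ... | ()

  load : Ω → Fin n → ℕ
  load ω v = ∑[ w ∈ allFin n ] (𝟙 (adj G v w) * 𝟙 (isSampled ω w))

  length-queue₀ : ∀ ω v → length (queue₀ ω v) ≤ load ω v
  length-queue₀ ω v = begin
    length (queue₀ ω v)
      ≡⟨ trans (length-filterᵇ sampled (map (cardsAt ω v) ports′)) (∑-map (cardsAt ω v) ports′ (𝟙 ∘ sampled)) ⟩
    ∑[ p ∈ ports′ ] 𝟙 (isSampled ω (neighbour v p))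
      ≤⟨ ∑-mono ports′ (λ p → 𝟙≤ λ s → ≤-trans
           (*-mono-≤ (1≤𝟙 (fromWitness {a? = neighbour v p ≟ neighbour v p} refl)) (1≤𝟙 s))
           (≤-∑ (λ w → 𝟙 (isYes (neighbour v p ≟ w)) * 𝟙 (isSampled ω w)) (∈-allFin (neighbour v p)))) ⟩
    ∑[ p ∈ ports′ ] ∑[ w ∈ allFin n ] (𝟙 (isYes (neighbour v p ≟ w)) * 𝟙 (isSampled ω w))
      ≡⟨ ∑-comm ports′ (allFin n) (λ p w → 𝟙 (isYes (neighbour v p ≟ w)) * 𝟙 (isSampled ω w)) ⟩
    ∑[ w ∈ allFin n ] ∑[ p ∈ ports′ ] (𝟙 (isYes (neighbour v p ≟ w)) * 𝟙 (isSampled ω w))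
      ≡⟨ ∑-cong (allFin n) (λ w → sym (∑-* (𝟙 (isSampled ω w)) ports′ (λ p → 𝟙 (isYes (neighbour v p ≟ w))))) ⟩
    ∑[ w ∈ allFin n ] (∑[ p ∈ ports′ ] 𝟙 (isYes (neighbour v p ≟ w)) * 𝟙 (isSampled ω w))
      ≤⟨ ∑-mono (allFin n) (λ w → *-monoˡ-≤ (𝟙 (isSampled ω w)) (leading-to w)) ⟩
    load ω v ∎
    where
    open ≤-Reasoning
    ports′ : List (Fin (degree network v))
    ports′ = allFin _
    leading-to : ∀ w → ∑[ p ∈ ports′ ] 𝟙 (isYes (neighbour v p ≟ w)) ≤ 𝟙 (adj G v w)
    leading-to w with adj G v w in vw
    ... | true  = ∑-unique (allFin⁺ _) _ λ {p} {p′} e e′ → neighbour-injective v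
      (trans (toWitness {a? = neighbour v p ≟ w} e) (sym (toWitness {a? = neighbour v p′ ≟ w} e′)))
    ... | false = ≤-reflexive (trans (∑-cong ports′ λ p → 𝟙-false λ e →
        subst T vw (subst (T ∘ adj G v) (toWitness {a? = neighbour v p ≟ w} e) (neighbour-adj v p)))
      (trans (∑-const ports′ 0) (*-zeroʳ (length ports′))))

  respectsBandwidth : RespectsBandwidth (suc κ)
  respectsBandwidth ω t _ v p = within t
    where
    -- A node with a port has a neighbour, so the graph has two nodes and one extra `⌈log₂ n ⌉` pays
    -- for the sampling bit in front of the identifier.
    1≤log : 1 ≤ ⌈log₂ n ⌉
    1≤log = ⌈log₂⌉-mono-≤ (distinct⇒2≤ (adj⇒≢ G (neighbour-adj v p)))
      where
      distinct⇒2≤ : ∀ {n} {i j : Fin n} → i ≢ j → 2 ≤ n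
      distinct⇒2≤ {suc zero}    {zero} {zero} i≢j = contradiction refl i≢j
      distinct⇒2≤ {suc (suc n)} _ = s≤s (s≤s z≤n)
    card-short : ∀ w → length (card ω w) ≤ suc κ * ⌈log₂ n ⌉
    card-short w = +-mono-≤ 1≤log (ident-short w)
    within : ∀ t → length (Algorithm.send (protocol rounds coins) (state ω t v) p) ≤ suc κ * ⌈log₂ n ⌉
    within zero    = card-short v
    within (suc t) with state ω (suc t) v | state-suc ω t v
    ... | _ | _ , refl , _ with next-drop t (queue₀ ω v)
    ...   | inj₁ silent = ≤-trans (≤-reflexive (cong length silent)) z≤n
    ...   | inj₂ x∈ with ∈-queue₀⁻ {ω} {v} x∈
    ...     | w , _ , x≡ = ≤-trans (≤-reflexive (cong length x≡)) (card-short w)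

  -- A card is never empty, so it cannot be mistaken for silence, and unique identifiers make it
  -- name one node.
  reports⇒adj : ∀ {ω t v p p′} → Reports (cardsAt ω v) (heardAt ω t v) p p′ →
    T (adj G (neighbour v p) (neighbour v p′))
  reports⇒adj {ω} {t} {v} {p} r with ∈-heardAt⁻ {ω} t {v} {p} r
  ... | inj₁ ()
  ... | inj₂ x∈ with ∈-queue₀⁻ {ω} x∈
  ...   | w , vw , x≡ = subst (T ∘ adj G _) (sym (card-injective ω x≡)) vw

  -- The node never compares the four ports: ten adjacencies force five distinct vertices, because
  -- adjacency is irreflexive.
  cliqueSeen⇒K₅ : ∀ {ω t v} → CliqueSeen (cardsAt ω v) (heardAt ω t v) → Contains (complete 5) G
  cliqueSeen⇒K₅ {ω} {t} {u} (v , a , b , c , va , vb , vc , ab , ac , bc) = f , f-injective , λ {i} {j} e →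
      f-adj i j (toWitness {a? = ¬? (i ≟ j)} e)
    where
    f : Fin 5 → Fin n
    f zero                         = u
    f (suc zero)                   = neighbour u v
    f (suc (suc zero))             = neighbour u a
    f (suc (suc (suc zero)))       = neighbour u b
    f (suc (suc (suc (suc zero)))) = neighbour u c

    edge : ∀ {p p′} → Reports (cardsAt ω u) (heardAt ω t u) p p′ → T (adj G (neighbour u p) (neighbour u p′))
    edge = reports⇒adj {ω} {t} {u}

    f-adj< : ∀ i j → i Fin.< j → T (adj G (f i) (f j))
    f-adj< zero (suc zero) _                   = neighbour-adj u v
    f-adj< zero (suc (suc zero)) _             = neighbour-adj u a
    f-adj< zero (suc (suc (suc zero))) _       = neighbour-adj u b
    f-adj< zero (suc (suc (suc (suc zero)))) _ = neighbour-adj u c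
    f-adj< (suc zero) (suc (suc zero)) _             = edge va
    f-adj< (suc zero) (suc (suc (suc zero))) _       = edge vb
    f-adj< (suc zero) (suc (suc (suc (suc zero)))) _ = edge vc
    f-adj< (suc (suc zero)) (suc (suc (suc zero))) _       = edge ab
    f-adj< (suc (suc zero)) (suc (suc (suc (suc zero)))) _ = edge ac
    f-adj< (suc (suc (suc zero))) (suc (suc (suc (suc zero)))) _ = edge bc
    f-adj< (suc zero) (suc zero) (s≤s ())
    f-adj< (suc (suc zero)) (suc zero) (s≤s ())
    f-adj< (suc (suc zero)) (suc (suc zero)) (s≤s (s≤s ()))
    f-adj< (suc (suc (suc zero))) (suc zero) (s≤s ())
    f-adj< (suc (suc (suc zero))) (suc (suc zero)) (s≤s (s≤s ()))
    f-adj< (suc (suc (suc zero))) (suc (suc (suc zero))) (s≤s (s≤s (s≤s ())))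
    f-adj< (suc (suc (suc (suc zero)))) (suc zero) (s≤s ())
    f-adj< (suc (suc (suc (suc zero)))) (suc (suc zero)) (s≤s (s≤s ()))
    f-adj< (suc (suc (suc (suc zero)))) (suc (suc (suc zero))) (s≤s (s≤s (s≤s ())))
    f-adj< (suc (suc (suc (suc zero)))) (suc (suc (suc (suc zero)))) (s≤s (s≤s (s≤s (s≤s ()))))

    f-adj : ∀ i j → i ≢ j → T (adj G (f i) (f j))
    f-adj i j i≢j with <-cmp i j
    ... | tri< i<j _ _ = f-adj< i j i<j
    ... | tri≈ _ i≡j _ = contradiction i≡j i≢j
    ... | tri> _ _ j<i = adj-sym G (f-adj< j i j<i)

    f-injective : Injective _≡_ _≡_ f
    f-injective {i} {j} fi≡fj with i ≟ j
    ... | yes i≡j = i≡j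
    ... | no i≢j  = contradiction fi≡fj (adj⇒≢ G (f-adj i j i≢j))

  K₅-free⇒allAccept : K 5 -free G → ∀ ω → T (allAccept ω)
  K₅-free⇒allAccept free ω = all⁺ (allFin n) λ v → accepting (rounds m̃) v
    where
    all⁺ : ∀ {p : Fin n → Bool} vs → (∀ v → T (p v)) → T (all p vs)
    all⁺ []       h = _
    all⁺ (v ∷ vs) h = Equivalence.from T-∧ (h v , all⁺ vs h)
    accepting : ∀ t v → T (Algorithm.accepts (protocol rounds coins) (state ω t v))
    accepting zero    v = _
    accepting (suc t) v with state ω (suc t) v | state-suc ω t v
    ... | _ | heard , refl , heard≡ with cliqueSeen? (cardsAt ω v) heard
    ...   | no _  = _
    ...   | yes (a , b , c , d , seen) = free (cliqueSeen⇒K₅ {ω} {t} {v} (a , b , c , d , transport seen))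
      where
      to : ∀ {p p′} → Reports (cardsAt ω v) heard p p′ → Reports (cardsAt ω v) (heardAt ω t v) p p′
      to {p} r = subst (_ ∈_) (heard≡ p) r
      transport : _ → _
      transport (r₁ , r₂ , r₃ , r₄ , r₅ , r₆) = to r₁ , to r₂ , to r₃ , to r₄ , to r₅ , to r₆

  -- Vertices 1, 2, 3 speak about vertices 2, 3, 4, while vertex 0 only listens, so no bound on its
  -- load is asked. One of the `suc t` rounds goes to the cards, which leaves `t` for the queues.
  K₅-sampled⇒someRejects : ∀ {t} → rounds m̃ ≡ suc t → (f : Fin 5 → Fin n) →
    (∀ {i j} → i ≢ j → T (adj G (f i) (f j))) → ∀ ω →
    (∀ i → T (isSampled ω (f (suc (suc i))))) →
    (∀ (i : Fin 3) → load ω (f (suc (inject₁ i))) ≤ t) →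
    T (someRejects ω)
  K₅-sampled⇒someRejects {t} rounds≡ f f-adj ω all-sampled fits =
    any⁺ (∈-allFin u) (subst (λ r → T (not (Algorithm.accepts (protocol rounds coins) (state ω r u))))
                             (sym rounds≡) rejecting)
    where
    u : Fin n
    u = f zero
    any⁺ : ∀ {p : Fin n → Bool} {vs v} → v ∈ vs → T (p v) → T (any p vs)
    any⁺ {p} (here refl) h = Equivalence.from Bool.T-∨ (inj₁ h)
    any⁺ {p} (there v∈)  h = Equivalence.from Bool.T-∨ (inj₂ (any⁺ v∈ h))
    port-of : ∀ i → ∃ λ p → neighbour u p ≡ f (suc i)
    port-of i = port (f-adj λ ())
    π : ∀ i → Fin (degree network u)
    π i = proj₁ (port-of i)
    reports : ∀ i j → inject₁ i ≢ suc j → Reports (cardsAt ω u) (heardAt ω t u) (π (inject₁ i)) (π (suc j))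
    reports i j i≢j = ∈-heardAt⁺ {ω} {u} t
      (subst₂ (λ x y → T (adj G x y)) (sym (proj₂ (port-of (inject₁ i)))) (sym (proj₂ (port-of (suc j))))
              (f-adj (i≢j ∘ Fin.suc-injective)))
      (subst (T ∘ isSampled ω) (sym (proj₂ (port-of (suc j)))) (all-sampled j))
      (≤-trans (length-queue₀ ω _)
        (subst (λ x → load ω x ≤ t) (sym (proj₂ (port-of (inject₁ i)))) (fits i)))
    seen : CliqueSeen (cardsAt ω u) (heardAt ω t u)
    seen = π zero , π (suc zero) , π (suc (suc zero)) , π (suc (suc (suc zero))) ,
      reports zero zero (λ ()) , reports zero (suc zero) (λ ()) , reports zero (suc (suc zero)) (λ ()) ,
      reports (suc zero) (suc zero) (λ ()) , reports (suc zero) (suc (suc zero)) (λ ()) ,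
      reports (suc (suc zero)) (suc (suc zero)) (λ ())
    rejecting : T (not (Algorithm.accepts (protocol rounds coins) (state ω (suc t) u)))
    rejecting with state ω (suc t) u | state-suc ω t u
    ... | _ | heard , refl , heard≡ with cliqueSeen? (cardsAt ω u) heard
    ...   | yes _  = _
    ...   | no ¬seen = let (p₁ , p₂ , p₃ , p₄ , r₁ , r₂ , r₃ , r₄ , r₅ , r₆) = seen in
        ¬seen (p₁ , p₂ , p₃ , p₄ , to r₁ , to r₂ , to r₃ , to r₄ , to r₅ , to r₆)
      where
      to : ∀ {p p′} → Reports (cardsAt ω u) (heardAt ω t u) p p′ → Reports (cardsAt ω u) heard p p′
      to {p} r = subst (_ ∈_) (sym (heard≡ p)) r

-- The second moment of the number of sampled cliques

2xy≤x²+y² : ∀ x y → 2 * (x * y) ≤ x * x + y * y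
2xy≤x²+y² x y = [ ordered
                , subst₂ _≤_ (cong (2 *_) (*-comm y x)) (+-comm (y * y) (x * x)) ∘ ordered
                ]′ (≤-total x y)
  where
  ordered : ∀ {x y} → x ≤ y → 2 * (x * y) ≤ x * x + y * y
  ordered {x} x≤y with m≤n⇒∃[o]m+o≡n x≤y
  ... | o , refl = ≤-trans (m≤m+n _ (o * o)) (≤-reflexive (square x o))
    where
    square : ∀ x o → 2 * (x * (x + o)) + o * o ≡ x * x + (x + o) * (x + o)
    square = solve-∀

∑-unanimous : ∀ r → ∑[ bs ∈ vectors (true ∷ false ∷ []) r ] 𝟙 (unanimous bs) ≡ 1
∑-unanimous zero    = refl
∑-unanimous (suc r) = begin
  ∑[ bs ∈ vectors bits (suc r) ] 𝟙 (unanimous bs)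
    ≡⟨ ∑-cartesianProductWith Vec._∷_ bits (vectors bits r) _ ⟩
  ∑[ bs ∈ vectors bits r ] 𝟙 (unanimous bs) + (∑[ bs ∈ vectors bits r ] 0 + 0)
    ≡⟨ cong₂ (λ x y → x + (y + 0)) (∑-unanimous r)
             (trans (∑-const (vectors bits r) 0) (*-zeroʳ (length (vectors bits r)))) ⟩
  1 ∎
  where
  open ≡-Reasoning
  bits : List Bool
  bits = true ∷ false ∷ []

length-vectors : ∀ {A : Set} (xs : List A) k → length (vectors xs k) ≡ length xs ^ k
length-vectors xs zero    = refl
length-vectors xs (suc k) = begin
  length (vectors xs (suc k))             ≡⟨ ∑-one (vectors xs (suc k)) ⟨
  ∑[ _ ∈ vectors xs (suc k) ] 1           ≡⟨ ∑-cartesianProductWith Vec._∷_ xs (vectors xs k) _ ⟩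
  ∑[ _ ∈ xs ] ∑[ _ ∈ vectors xs k ] 1     ≡⟨ ∑-const xs _ ⟩
  length xs * ∑[ _ ∈ vectors xs k ] 1     ≡⟨ cong (length xs *_) (trans (∑-one (vectors xs k)) (length-vectors xs k)) ⟩
  length xs ^ suc k                       ∎
  where open ≡-Reasoning

module SecondMoment {n : ℕ} (G : Graph n) (D B r : ℕ) where

  open Packings G D
  open Sampling (vectors (true ∷ false ∷ []) r) unanimous (∑-unanimous r) public

  Ω : Set
  Ω = Outcome n r

  Ωs : List Ω
  Ωs = outcomes n r

  #Ω : ℕ
  #Ω = length Ωs

  load : Ω → Fin n → ℕ
  load ω v = ∑[ w ∈ allFin n ] (𝟙 (adj G v w) * 𝟙 (unanimous (lookup ω w)))

  core : LightClique → List (Fin n)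
  core K = vertex K (suc (suc zero)) ∷ vertex K (suc (suc (suc zero))) ∷ vertex K (suc (suc (suc (suc zero)))) ∷ []

  q³ : ℕ
  q³ = q * q * q

  q*[q*[q*x]]≡q³*x : ∀ x → q * (q * (q * x)) ≡ q³ * x
  q*[q*[q*x]]≡q³*x x = assoc q x
    where
    assoc : ∀ q x → q * (q * (q * x)) ≡ q * q * q * x
    assoc = solve-∀

  q≥1 : 1 ≤ q
  q≥1 = begin
    1                                               ≡⟨ ∑-unanimous r ⟨
    ∑[ bs ∈ coins ] 𝟙 (unanimous bs)                ≤⟨ ∑-mono coins (λ bs → 𝟙≤1 (unanimous bs)) ⟩
    ∑[ _ ∈ coins ] 1                                ≡⟨ ∑-one coins ⟩
    q                                               ∎
    where
    open ≤-Reasoning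
    coins : List (Vec Bool r)
    coins = vectors (true ∷ false ∷ []) r

  count-core : ∀ K → q³ * count (core K) ≡ #Ω
  count-core K = begin
    q³ * count (core K)              ≡⟨ q*[q*[q*x]]≡q³*x _ ⟨
    q * (q * (q * count (core K)))   ≡⟨ count-triple {n} (distinct K λ ()) (distinct K λ ()) (distinct K λ ()) ⟩
    count {n} []                     ≡⟨ ∑-one Ωs ⟩
    #Ω                               ∎
    where open ≡-Reasoning

  overloaded : Ω → Fin n → Bool
  overloaded ω v = isYes (B ℕ.<? load ω v)

  ∑-occurrences : ∀ (L : List (Fin n)) → ∑[ w ∈ allFin n ] occurrences w L ≤ length L
  ∑-occurrences L = begin
    ∑[ w ∈ allFin n ] occurrences w L
      ≡⟨ ∑-comm (allFin n) L (λ w x → 𝟙 (isYes (w ≟ x))) ⟩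
    ∑[ x ∈ L ] ∑[ w ∈ allFin n ] 𝟙 (isYes (w ≟ x))
      ≤⟨ ∑-mono L (λ x → ∑-unique (allFin⁺ n) (λ w → isYes (w ≟ x)) λ {w} {w′} h h′ →
           trans (toWitness {a? = w ≟ x} h) (sym (toWitness {a? = w′ ≟ x} h′))) ⟩
    ∑[ x ∈ L ] 1
      ≡⟨ ∑-one L ⟩
    length L ∎
    where open ≤-Reasoning

  module _ (K : LightClique) where

    speakers-fit? : ∀ ω → Dec (∀ (i : Fin 3) → load ω (vertex K (suc (inject₁ i))) ≤ B)
    speakers-fit? ω = all? λ i → load ω (vertex K (suc (inject₁ i))) ≤? B

    detected : Ω → ℕ
    detected ω = hits (core K) ω * 𝟙 (isYes (speakers-fit? ω))

    detected≤hits : ∀ ω → detected ω ≤ hits (core K) ω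
    detected≤hits ω = ≤-trans (*-monoʳ-≤ (hits (core K) ω) (𝟙≤1 _)) (≤-reflexive (*-identityʳ _))

    -- Markov's inequality conditioned on a sampled core. The conditional mean load of `v` is at
    -- most `D / q + 3`, where 3 stands for the core vertices that are now certain to be sampled,
    -- and `suc B` is at least 27 times that.
    count-overloaded : 27 * (D + 3 * q) ≤ q * suc B → ∀ {v} → Light v →
      27 * ∑[ ω ∈ Ωs ] (hits (core K) ω * 𝟙 (overloaded ω v)) ≤ count (core K)
    count-overloaded fits {v} light-v = *-cancelˡ-≤ (D + 3 * q) {{D+3q≢0}} (begin
      (D + 3 * q) * (27 * bad)
        ≡⟨ rearrange (D + 3 * q) bad ⟩
      27 * (D + 3 * q) * bad
        ≤⟨ *-monoˡ-≤ bad fits ⟩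
      q * suc B * bad
        ≡⟨ trans (*-assoc q (suc B) bad) (cong (q *_) (trans (*-comm (suc B) bad) (∑-* (suc B) Ωs _))) ⟩
      q * ∑[ ω ∈ Ωs ] (hits L ω * 𝟙 (overloaded ω v) * suc B)
        ≤⟨ *-monoʳ-≤ q (∑-mono Ωs markov) ⟩
      q * ∑[ ω ∈ Ωs ] ∑[ w ∈ V ] (𝟙 (adj G v w) * hits (w ∷ L) ω)
        ≡⟨ cong (q *_) (trans (∑-comm Ωs V (λ ω w → 𝟙 (adj G v w) * hits (w ∷ L) ω))
             (∑-cong V λ w → sym (*-∑ (𝟙 (adj G v w)) Ωs (hits (w ∷ L))))) ⟩
      q * ∑[ w ∈ V ] (𝟙 (adj G v w) * count (w ∷ L))
        ≡⟨ *-∑ q V _ ⟩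
      ∑[ w ∈ V ] (q * (𝟙 (adj G v w) * count (w ∷ L)))
        ≤⟨ ∑-mono V extra ⟩
      ∑[ w ∈ V ] ((𝟙 (adj G v w) + occurrences w L * q) * count L)
        ≡⟨ trans (sym (∑-* (count L) V _)) (cong (_* count L) (trans (∑-+ V _ _)
             (cong (deg G v +_) (sym (∑-* q V (λ w → occurrences w L)))))) ⟩
      (deg G v + ∑[ w ∈ V ] occurrences w L * q) * count L
        ≤⟨ *-monoˡ-≤ (count L) (+-mono-≤ light-v (*-monoˡ-≤ q (∑-occurrences L))) ⟩
      (D + 3 * q) * count L ∎)
      where
      open ≤-Reasoning
      L V : List (Fin n)
      L = core K
      V = allFin n
      bad : ℕ
      bad = ∑[ ω ∈ Ωs ] (hits L ω * 𝟙 (overloaded ω v))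
      D+3q≢0 : NonZero (D + 3 * q)
      D+3q≢0 = >-nonZero (≤-trans q≥1 (≤-trans (m≤m+n q _) (m≤n+m (3 * q) D)))
      rearrange : ∀ x y → x * (27 * y) ≡ 27 * x * y
      rearrange = solve-∀
      markov : ∀ ω → hits L ω * 𝟙 (overloaded ω v) * suc B ≤ ∑[ w ∈ V ] (𝟙 (adj G v w) * hits (w ∷ L) ω)
      markov ω = begin
        hits L ω * 𝟙 (overloaded ω v) * suc B
          ≡⟨ *-assoc (hits L ω) _ (suc B) ⟩
        hits L ω * (𝟙 (overloaded ω v) * suc B)
          ≤⟨ *-monoʳ-≤ (hits L ω) over ⟩
        hits L ω * load ω v
          ≡⟨ *-∑ (hits L ω) V _ ⟩
        ∑[ w ∈ V ] (hits L ω * (𝟙 (adj G v w) * 𝟙 (unanimous (lookup ω w))))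
          ≡⟨ ∑-cong V (λ w → shuffle (hits L ω) (𝟙 (adj G v w)) (𝟙 (unanimous (lookup ω w)))) ⟩
        ∑[ w ∈ V ] (𝟙 (adj G v w) * hits (w ∷ L) ω) ∎
        where
        shuffle : ∀ x y z → x * (y * z) ≡ y * (z * x)
        shuffle = solve-∀
        over : 𝟙 (overloaded ω v) * suc B ≤ load ω v
        over with B ℕ.<? load ω v
        ... | yes B<load = ≤-trans (≤-reflexive (*-identityˡ (suc B))) B<load
        ... | no _       = z≤n
      extra : ∀ w → q * (𝟙 (adj G v w) * count (w ∷ L)) ≤ (𝟙 (adj G v w) + occurrences w L * q) * count L
      extra w with adj G v w
      ... | false = ≤-trans (≤-reflexive (*-zeroʳ q)) z≤n
      ... | true  = ≤-trans (≤-reflexive (cong (q *_) (*-identityˡ _))) (count-∷ w L)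

    -- A union bound over the three speakers: each is overloaded with conditional probability at
    -- most 1/27, which leaves 8/9.
    count≤detected : 27 * (D + 3 * q) ≤ q * suc B → 8 * count (core K) ≤ 9 * ∑ Ωs detected
    count≤detected fits = *-cancelˡ-≤ 3 (+-cancelʳ-≤ (3 * c) _ _ (begin
      3 * (8 * c) + 3 * c
        ≡⟨ split c ⟩
      27 * c
        ≤⟨ *-monoʳ-≤ 27 (∑-mono Ωs caught) ⟩
      27 * ∑[ ω ∈ Ωs ] (detected ω + ∑[ i ∈ allFin 3 ] (hits L ω * 𝟙 (overloaded ω (speaker i))))
        ≡⟨ cong (27 *_) (trans (∑-+ Ωs _ _) (cong (∑ Ωs detected +_)
             (∑-comm Ωs (allFin 3) (λ ω i → hits L ω * 𝟙 (overloaded ω (speaker i)))))) ⟩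
      27 * (∑ Ωs detected + ∑[ i ∈ allFin 3 ] ∑[ ω ∈ Ωs ] (hits L ω * 𝟙 (overloaded ω (speaker i))))
        ≡⟨ trans (*-distribˡ-+ 27 (∑ Ωs detected) _) (cong (27 * ∑ Ωs detected +_)
             (*-∑ 27 (allFin 3) (λ i → ∑[ ω ∈ Ωs ] (hits L ω * 𝟙 (overloaded ω (speaker i)))))) ⟩
      27 * ∑ Ωs detected + ∑[ i ∈ allFin 3 ] (27 * ∑[ ω ∈ Ωs ] (hits L ω * 𝟙 (overloaded ω (speaker i))))
        ≤⟨ +-monoʳ-≤ (27 * ∑ Ωs detected) (∑-≤const (allFin 3) λ i → count-overloaded fits (light K (inject₁ i))) ⟩
      27 * ∑ Ωs detected + 3 * c
        ≡⟨ cong (_+ 3 * c) (*-assoc 3 9 (∑ Ωs detected)) ⟩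
      3 * (9 * ∑ Ωs detected) + 3 * c ∎))
      where
      open ≤-Reasoning
      L : List (Fin n)
      L = core K
      c : ℕ
      c = count L
      speaker : Fin 3 → Fin n
      speaker i = vertex K (suc (inject₁ i))
      split : ∀ c → 3 * (8 * c) + 3 * c ≡ 27 * c
      split = solve-∀
      caught : ∀ ω → hits L ω ≤ detected ω + ∑[ i ∈ allFin 3 ] (hits L ω * 𝟙 (overloaded ω (speaker i)))
      caught ω with speakers-fit? ω
      ... | yes _ = ≤-trans (≤-reflexive (sym (*-identityʳ _))) (m≤m+n _ _)
      ... | no ¬fit with ¬∀⟶∃¬ 3 _ (λ i → load ω (speaker i) ≤? B) ¬fit
      ...   | i , over = begin
        hits L ω                                    ≡⟨ *-identityʳ _ ⟨
        hits L ω * 1                                ≤⟨ *-monoʳ-≤ (hits L ω) (1≤𝟙 (fromWitness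
                                                         {a? = B ℕ.<? load ω (speaker i)} (≰⇒> over))) ⟩
        hits L ω * 𝟙 (overloaded ω (speaker i))
          ≤⟨ ≤-∑ (λ i → hits L ω * 𝟙 (overloaded ω (speaker i))) (∈-allFin i) ⟩
        ∑[ i ∈ allFin 3 ] (hits L ω * 𝟙 (overloaded ω (speaker i)))
          ≤⟨ m≤n+m _ (hits L ω * 0) ⟩
        hits L ω * 0 + ∑[ i ∈ allFin 3 ] (hits L ω * 𝟙 (overloaded ω (speaker i))) ∎

  #sampled : List LightClique → Ω → ℕ
  #sampled P ω = ∑[ K ∈ P ] hits (core K) ω

  module _ {P : List LightClique} (packing : IsPacking P) where

    private
      -- Only the linear term must keep its factor `q`, since its sum over the packing grows with
      -- the degrees. The quadratic terms have bounded sums and are relaxed to `q * q * q`; the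
      -- cubic term joins them through `γ ≤ 3`.
      product-bound : ∀ q α β γ → 1 ≤ q → γ ≤ 3 →
        (1 + α * q) * (1 + β * q) * (1 + γ * q) ≤
        1 + ((α + β + γ) * q + 4 * (α * β + α * γ + β * γ) * (q * q * q))
      product-bound q α β γ 1≤q γ≤3 = begin
        (1 + α * q) * (1 + β * q) * (1 + γ * q)
          ≡⟨ expand q α β γ ⟩
        1 + ((α + β + γ) * q + (S * (1 * (q * q)) + α * β * γ * (q * q * q)))
          ≤⟨ +-monoʳ-≤ 1 (+-monoʳ-≤ ((α + β + γ) * q) (+-mono-≤
               (*-monoʳ-≤ S (*-monoˡ-≤ (q * q) 1≤q))
               (*-monoˡ-≤ (q * q * q) (*-mono-≤ (≤-trans (m≤m+n (α * β) _) (m≤m+n (α * β + α * γ) _)) γ≤3)))) ⟩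
        1 + ((α + β + γ) * q + (S * (q * (q * q)) + S * 3 * (q * q * q)))
          ≡⟨ collect q ((α + β + γ) * q) S ⟩
        1 + ((α + β + γ) * q + 4 * S * (q * q * q)) ∎
        where
        open ≤-Reasoning
        S : ℕ
        S = α * β + α * γ + β * γ
        expand : ∀ q α β γ → (1 + α * q) * (1 + β * q) * (1 + γ * q) ≡
          1 + ((α + β + γ) * q + ((α * β + α * γ + β * γ) * (1 * (q * q)) + α * β * γ * (q * q * q)))
        expand = solve-∀
        collect : ∀ q x S → 1 + (x + (S * (q * (q * q)) + S * 3 * (q * q * q))) ≡ 1 + (x + 4 * S * (q * q * q))
        collect = solve-∀

      module _ (L : List (Fin n)) (L≡3 : length L ≡ 3) (∑deg : ∑ L (deg G) ≤ 3 * D) where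

        occ : Fin 4 → LightClique → ℕ
        occ i K = occurrences (vertex K (suc i)) L

        occ≤3 : ∀ i K → occ i K ≤ 3
        occ≤3 i K = ≤-trans (∑-mono L (λ w → 𝟙≤1 _)) (≤-reflexive (trans (∑-one L) L≡3))

        ∑-occ : ∀ i → ∑ P (occ i) ≤ 3 * D
        ∑-occ i = ≤-trans (≤-reflexive (∑-comm P L (λ K w → 𝟙 (isYes (vertex K (suc i) ≟ w)))))
                          (≤-trans (∑-mono L (∑-vertex≤deg {P} packing i)) ∑deg)

        -- `L` has nine ordered pairs, and each sits in positions `i` and `j` of at most one clique.
        ∑-occ² : ∀ {i j} → suc i ≢ suc j → ∑[ K ∈ P ] (occ i K * occ j K) ≤ 9
        ∑-occ² {i} {j} i≢j = begin
          ∑[ K ∈ P ] (occ i K * occ j K)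
            ≡⟨ ∑-cong P (λ K → trans (∑-* (occ j K) L _) (∑-cong L λ w → *-∑ (at i K w) L (at j K))) ⟩
          ∑[ K ∈ P ] ∑[ w ∈ L ] ∑[ x ∈ L ] (at i K w * at j K x)
            ≡⟨ trans (∑-comm P L _) (∑-cong L λ w → ∑-comm P L (λ K x → at i K w * at j K x)) ⟩
          ∑[ w ∈ L ] ∑[ x ∈ L ] ∑[ K ∈ P ] (at i K w * at j K x)
            ≤⟨ ∑-≤const L (λ w → ∑-≤const L (∑-pair≤1 {P} packing i≢j w)) ⟩
          length L * (length L * 1)
            ≡⟨ cong (λ l → l * (l * 1)) L≡3 ⟩
          9 ∎
          where
          open ≤-Reasoning
          at : Fin 4 → LightClique → Fin n → ℕ
          at i K w = 𝟙 (isYes (vertex K (suc i) ≟ w))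

        -- Given that `L` is sampled, independence would give `length P`. The excess is split by the
        -- number of coincidences of a core with `L`: single ones yield `9 * (D * q)`, multiple ones
        -- `108 * q³`.
        overlaps : ∑[ K ∈ P ] (q³ * count (core K ++ L)) ≤ (length P + (9 * (D * q) + 108 * q³)) * count L
        overlaps = begin
          ∑[ K ∈ P ] (q³ * count (core K ++ L))
            ≤⟨ ∑-mono P (λ K → ≤-trans (≤-reflexive (sym (q*[q*[q*x]]≡q³*x _)))
                 (≤-trans (count-∷³ L (distinct K λ ()) (distinct K λ ()) (distinct K λ ()))
                 (*-monoˡ-≤ (count L) (product-bound q (α K) (β K) (γ K) q≥1 (occ≤3 (suc (suc (suc zero))) K))))) ⟩
          ∑[ K ∈ P ] ((1 + ((α K + β K + γ K) * q + 4 * (α K * β K + α K * γ K + β K * γ K) * q³)) * count L)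
            ≡⟨ ∑-* (count L) P _ ⟨
          ∑[ K ∈ P ] (1 + ((α K + β K + γ K) * q + 4 * (α K * β K + α K * γ K + β K * γ K) * q³)) * count L
            ≡⟨ cong (_* count L) (trans (∑-+ P _ _) (cong₂ _+_ (∑-one P) (trans (∑-+ P _ _) (cong₂ _+_
                 (trans (sym (∑-* q P _)) (cong (_* q) (trans (∑-+ P _ _) (cong (_+ ∑ P γ) (∑-+ P α β)))))
                 (trans (sym (∑-* q³ P _)) (cong (_* q³) (trans (sym (*-∑ 4 P _)) (cong (4 *_)
                   (trans (∑-+ P _ _) (cong (_+ ∑[ K ∈ P ] (β K * γ K)) (∑-+ P _ _)))))))))) ) ⟩
          (length P + ((∑ P α + ∑ P β + ∑ P γ) * q +
             4 * (∑[ K ∈ P ] (α K * β K) + ∑[ K ∈ P ] (α K * γ K) + ∑[ K ∈ P ] (β K * γ K)) * q³)) * count L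
            -- Three core positions contribute `3 * D` each, three pairs of positions contribute 9
            -- each, and 4 times 27 is 108.
            ≤⟨ *-monoˡ-≤ (count L) (+-monoʳ-≤ (length P) (+-mono-≤
                 (*-monoˡ-≤ q (+-mono-≤ (+-mono-≤ (∑-occ _) (∑-occ _)) (∑-occ _)))
                 (*-monoˡ-≤ q³ (*-monoʳ-≤ 4 (+-mono-≤ (+-mono-≤ (∑-occ² λ ()) (∑-occ² λ ())) (∑-occ² λ ())))))) ⟩
          (length P + ((3 * D + 3 * D + 3 * D) * q + 108 * q³)) * count L
            ≡⟨ cong (λ x → (length P + (x + 108 * q³)) * count L) (nine D q) ⟩
          (length P + (9 * (D * q) + 108 * q³)) * count L ∎
          where
          open ≤-Reasoning
          α β γ : LightClique → ℕ
          α = occ (suc zero)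
          β = occ (suc (suc zero))
          γ = occ (suc (suc (suc zero)))
          nine : ∀ D q → (3 * D + 3 * D + 3 * D) * q ≡ 9 * (D * q)
          nine = solve-∀

    -- The square counts ordered pairs of cliques; with one of them fixed, `overlaps` is applied to
    -- its core.
    second-moment : q³ * q³ * ∑[ ω ∈ Ωs ] (#sampled P ω * #sampled P ω) ≤
                    length P * ((length P + (9 * (D * q) + 108 * q³)) * #Ω)
    second-moment = begin
      q³ * q³ * ∑[ ω ∈ Ωs ] (#sampled P ω * #sampled P ω)
        ≡⟨ cong (q³ * q³ *_) pairs-of-cliques ⟩
      q³ * q³ * ∑[ K ∈ P ] ∑[ K′ ∈ P ] count (core K′ ++ core K)
        ≡⟨ trans (*-assoc q³ q³ _) (trans (cong (q³ *_) (*-∑ q³ P _)) (*-∑ q³ P _)) ⟩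
      ∑[ K ∈ P ] (q³ * (q³ * ∑[ K′ ∈ P ] count (core K′ ++ core K)))
        ≤⟨ ∑-mono P (λ K → *-monoʳ-≤ q³ (≤-trans (≤-reflexive (*-∑ q³ P _)) (overlaps (core K) refl (core-light K)))) ⟩
      ∑[ K ∈ P ] (q³ * (W * count (core K)))
        ≡⟨ ∑-cong P (λ K → trans (x∙yz≈y∙xz q³ W _) (cong (W *_) (count-core K))) ⟩
      ∑[ K ∈ P ] (W * #Ω)
        ≡⟨ ∑-const P _ ⟩
      length P * (W * #Ω) ∎
      where
      open ≤-Reasoning
      open import Algebra.Properties.CommutativeSemigroup *-commutativeSemigroup using (x∙yz≈y∙xz)
      W : ℕ
      W = length P + (9 * (D * q) + 108 * q³)
      core-light : ∀ K → ∑ (core K) (deg G) ≤ 3 * D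
      core-light K = +-mono-≤ (light K _) (+-mono-≤ (light K _) (+-mono-≤ (light K _) z≤n))
      hits-++ : ∀ K L ω → hits L ω * hits (core K) ω ≡ hits (core K ++ L) ω
      hits-++ K L ω = regroup (hits L ω) (hit zero) (hit (suc zero)) (hit (suc (suc zero)))
        where
        hit : Fin 3 → ℕ
        hit i = 𝟙 (unanimous (lookup ω (vertex K (suc (suc i)))))
        regroup : ∀ h x y z → h * (x * (y * (z * 1))) ≡ x * (y * (z * h))
        regroup = solve-∀
      pairs-of-cliques : ∑[ ω ∈ Ωs ] (#sampled P ω * #sampled P ω) ≡ ∑[ K ∈ P ] ∑[ K′ ∈ P ] count (core K′ ++ core K)
      pairs-of-cliques = trans
        (∑-cong Ωs λ ω → trans (∑-* (#sampled P ω) P _) (∑-cong P λ K →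
          trans (*-∑ (hits (core K) ω) P _) (∑-cong P λ K′ → hits-++ K′ (core K) ω)))
        (trans (∑-comm Ωs P _) (∑-cong P λ K → ∑-comm Ωs P (λ ω K′ → hits (core K′ ++ core K) ω)))

    -- z² lies above its tangent 2ℓz − ℓ² at ℓ, the mean number of sampled cliques;
    -- only outcomes in the event need the correction ℓ².
    likely : ∀ ℓ → 1 ≤ ℓ → length P ≡ ℓ * q³ → 27 * (D + 3 * q) ≤ q * suc B →
      9 * ∑[ ω ∈ Ωs ] (#sampled P ω * #sampled P ω) ≤ 10 * (ℓ * ℓ * #Ω) →
      (event : Ω → Bool) → (∀ K ω → 0 < detected K ω → T (event ω)) →
      2 * #Ω ≤ 3 * ∑[ ω ∈ Ωs ] 𝟙 (event ω)
    likely ℓ 1≤ℓ ∣P∣≡ fits variance event detects =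
      -- Up to the factor `9 * (ℓ * ℓ)`, twice the mean is at least 16/9, the second moment at most
      -- 10/9, and the difference is the required 2/3.
      *-cancelˡ-≤ (3 * (ℓ * ℓ)) {{>-nonZero (*-mono-≤ {1} {3} (s≤s z≤n) (*-mono-≤ 1≤ℓ 1≤ℓ))}}
      (+-cancelˡ-≤ (10 * (ℓ * ℓ * #Ω)) _ _ (begin
        10 * (ℓ * ℓ * #Ω) + 3 * (ℓ * ℓ) * (2 * #Ω)
          ≡⟨ sixteen ℓ #Ω ⟩
        2 * (ℓ * (8 * (ℓ * #Ω)))
          ≤⟨ *-monoʳ-≤ 2 (*-monoʳ-≤ ℓ mean) ⟩
        2 * (ℓ * (9 * ∑ Ωs Z))
          ≡⟨ nine ℓ (∑ Ωs Z) ⟩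
        9 * (2 * ℓ * ∑ Ωs Z)
          ≤⟨ *-monoʳ-≤ 9 (begin
               2 * ℓ * ∑ Ωs Z
                 ≡⟨ *-∑ (2 * ℓ) Ωs Z ⟩
               ∑[ ω ∈ Ωs ] (2 * ℓ * Z ω)
                 ≤⟨ ∑-mono Ωs tangent ⟩
               ∑[ ω ∈ Ωs ] (#sampled P ω * #sampled P ω + ℓ * ℓ * 𝟙 (event ω))
                 ≡⟨ trans (∑-+ Ωs _ _) (cong (S +_) (sym (*-∑ (ℓ * ℓ) Ωs _))) ⟩
               S + ℓ * ℓ * ∑[ ω ∈ Ωs ] 𝟙 (event ω) ∎) ⟩
        9 * (S + ℓ * ℓ * ∑[ ω ∈ Ωs ] 𝟙 (event ω))
          ≡⟨ *-distribˡ-+ 9 S _ ⟩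
        9 * S + 9 * (ℓ * ℓ * ∑[ ω ∈ Ωs ] 𝟙 (event ω))
          ≤⟨ +-monoˡ-≤ _ variance ⟩
        10 * (ℓ * ℓ * #Ω) + 9 * (ℓ * ℓ * ∑[ ω ∈ Ωs ] 𝟙 (event ω))
          ≡⟨ cong (10 * (ℓ * ℓ * #Ω) +_) (thrice (ℓ * ℓ) _) ⟩
        10 * (ℓ * ℓ * #Ω) + 3 * (ℓ * ℓ) * (3 * ∑[ ω ∈ Ωs ] 𝟙 (event ω)) ∎))
      where
      open ≤-Reasoning
      Z : Ω → ℕ
      Z ω = ∑[ K ∈ P ] (detected K ω)
      S : ℕ
      S = ∑[ ω ∈ Ωs ] (#sampled P ω * #sampled P ω)
      sixteen : ∀ ℓ N → 10 * (ℓ * ℓ * N) + 3 * (ℓ * ℓ) * (2 * N) ≡ 2 * (ℓ * (8 * (ℓ * N)))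
      sixteen = solve-∀
      nine : ∀ ℓ z → 2 * (ℓ * (9 * z)) ≡ 9 * (2 * ℓ * z)
      nine = solve-∀
      thrice : ∀ x y → 9 * (x * y) ≡ 3 * x * (3 * y)
      thrice = solve-∀
      Z≤ : ∀ ω → Z ω ≤ #sampled P ω
      Z≤ ω = ∑-mono P λ K → detected≤hits K ω
      -- The linear term needs a lower bound on a mean, so it counts detected cliques. The quadratic
      -- term needs an upper bound, so it is relaxed to sampled cliques, whose second moment is
      -- under control.
      tangent : ∀ ω → 2 * ℓ * Z ω ≤ #sampled P ω * #sampled P ω + ℓ * ℓ * 𝟙 (event ω)
      tangent ω with Z ω in eq
      ... | zero  = ≤-trans (≤-reflexive (*-zeroʳ (2 * ℓ))) z≤n
      ... | suc z = begin
        2 * ℓ * suc z                                ≡⟨ *-assoc 2 ℓ (suc z) ⟩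
        2 * (ℓ * suc z)                              ≡⟨ cong (2 *_) (*-comm ℓ (suc z)) ⟩
        2 * (suc z * ℓ)                              ≤⟨ 2xy≤x²+y² (suc z) ℓ ⟩
        suc z * suc z + ℓ * ℓ                        ≤⟨ +-monoˡ-≤ (ℓ * ℓ) (*-mono-≤ z≤ z≤) ⟩
        #sampled P ω * #sampled P ω + ℓ * ℓ          ≡⟨ cong (#sampled P ω * #sampled P ω +_)
                                                          (trans (cong (ℓ * ℓ *_) (𝟙-true occurs)) (*-identityʳ (ℓ * ℓ))) ⟨
        #sampled P ω * #sampled P ω + ℓ * ℓ * 𝟙 (event ω) ∎
        where
        z≤ : suc z ≤ #sampled P ω
        z≤ = subst (_≤ #sampled P ω) eq (Z≤ ω)
        occurs : T (event ω)
        occurs = let (K , pos) = ∑-positive P (λ K → detected K ω) (subst (0 <_) (sym eq) (s≤s z≤n))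
                 in detects K ω pos
      mean : 8 * (ℓ * #Ω) ≤ 9 * ∑ Ωs Z
      mean = *-cancelˡ-≤ q³ {{>-nonZero (*-mono-≤ (*-mono-≤ q≥1 q≥1) q≥1)}} (begin
        q³ * (8 * (ℓ * #Ω))
          ≡⟨ rotate q³ ℓ #Ω ⟩
        ℓ * q³ * (8 * #Ω)
          ≡⟨ cong (_* (8 * #Ω)) ∣P∣≡ ⟨
        length P * (8 * #Ω)
          ≡⟨ ∑-const P (8 * #Ω) ⟨
        ∑[ K ∈ P ] (8 * #Ω)
          ≡⟨ ∑-cong P (λ K → trans (cong (8 *_) (sym (count-core K))) (x∙yz≈y∙xz 8 q³ _)) ⟩
        ∑[ K ∈ P ] (q³ * (8 * count (core K)))
          ≤⟨ ∑-mono P (λ K → *-monoʳ-≤ q³ (count≤detected K fits)) ⟩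
        ∑[ K ∈ P ] (q³ * (9 * ∑ Ωs (detected K)))
          ≡⟨ *-∑ q³ P _ ⟨
        q³ * ∑[ K ∈ P ] (9 * ∑ Ωs (detected K))
          ≡⟨ cong (q³ *_) (trans (cong (9 *_) (∑-comm Ωs P (λ ω K → detected K ω)))
                                 (*-∑ 9 P (λ K → ∑ Ωs (detected K)))) ⟨
        q³ * (9 * ∑ Ωs Z) ∎)
        where
        open import Algebra.Properties.CommutativeSemigroup *-commutativeSemigroup using (x∙yz≈y∙xz)
        rotate : ∀ a b c → a * (8 * (b * c)) ≡ b * a * (8 * c)
        rotate = solve-∀

-- Probability bounds

⅔ : ℚ
⅔ = ℤ.+ 2 ℚ./ 3

fraction≡1 : ∀ k .{{_ : NonZero k}} → (ℤ.+ k) ℚ./ k ≡ 1ℚ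
fraction≡1 (suc k) = ℚ.fromℚᵘ-cong {mkℚᵘ (ℤ.+ suc k) k} {ℚᵘ.1ℚᵘ} (*≡* (ℤ.*-comm (ℤ.+ suc k) (ℤ.+ 1)))

2/3≤fraction : ∀ a b .{{_ : NonZero b}} → 2 * b ≤ 3 * a → ⅔ ℚ.≤ (ℤ.+ a) ℚ./ b
2/3≤fraction a (suc b) 2b≤3a = ℚ.toℚᵘ-cancel-≤
  (ℚᵘ.≤-respʳ-≃ (ℚᵘ.≃-sym (ℚ.toℚᵘ-fromℚᵘ (mkℚᵘ (ℤ.+ a) b)))
    (*≤* (subst₂ ℤ._≤_ (ℤ.pos-* 2 (suc b)) (trans (cong ℤ.+_ (*-comm 3 a)) (ℤ.pos-* a 3)) (+≤+ 2b≤3a))))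

2/3≤1 : ⅔ ℚ.≤ 1ℚ
2/3≤1 = subst (⅔ ℚ.≤_) (fraction≡1 1) (2/3≤fraction 1 1 (s≤s (s≤s z≤n)))

-- A positive rational is at least the inverse of its denominator, so `ε` may be replaced by 1 over
-- a natural number.
ε*m≤d⇒m≤↧ε*d : ∀ ε → 0ℚ ℚ.< ε → ∀ {m d} → ε ℚ.* ((ℤ.+ m) ℚ./ 1) ℚ.≤ (ℤ.+ d) ℚ./ 1 → m ≤ ℚ.↧ₙ ε * d
ε*m≤d⇒m≤↧ε*d (mkℚ (ℤ.+ zero) _ _)     (ℚ.*<* (+<+ ()))
ε*m≤d⇒m≤↧ε*d (mkℚ -[1+ _ ] _ _)     (ℚ.*<* ())
ε*m≤d⇒m≤↧ε*d ε@(mkℚ (ℤ.+ suc a) b _)  _ {m} {d} εm≤d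
  with ℚᵘ.≤-respʳ-≃ (ℚ.toℚᵘ-fromℚᵘ (mkℚᵘ (ℤ.+ d) 0))
       (ℚᵘ.≤-respˡ-≃ (ℚᵘ.≃-trans (ℚ.toℚᵘ-homo-* ε ((ℤ.+ m) ℚ./ 1))
                                  (ℚᵘ.*-congˡ {mkℚᵘ (ℤ.+ suc a) b} (ℚ.toℚᵘ-fromℚᵘ (mkℚᵘ (ℤ.+ m) 0))))
                     (ℚ.toℚᵘ-mono-≤ εm≤d))
... | *≤* le = begin
  m                       ≤⟨ m≤m+n m (a * m) ⟩
  suc a * m               ≤⟨ ℤ.drop‿+≤+ (subst₂ ℤ._≤_ lhs rhs le) ⟩
  d * suc b               ≡⟨ *-comm d (suc b) ⟩
  suc b * d               ∎
  where
  open ≤-Reasoning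
  lhs : (ℤ.+ suc a ℤ.* ℤ.+ m) ℤ.* ℤ.+ 1 ≡ ℤ.+ (suc a * m)
  lhs = trans (ℤ.*-identityʳ (ℤ.+ suc a ℤ.* ℤ.+ m)) (sym (ℤ.pos-* (suc a) m))
  rhs : ℤ.+ d ℤ.* ℤ.+ (suc b * 1) ≡ ℤ.+ (d * suc b)
  rhs = trans (cong (λ x → ℤ.+ d ℤ.* ℤ.+ x) (*-identityʳ (suc b))) (sym (ℤ.pos-* d (suc b)))

length-outcomes : ∀ n r → length (outcomes n r) ≡ 2 ^ (n * r)
length-outcomes n r = begin
  length (outcomes n r)                                ≡⟨ length-vectors (vectors (true ∷ false ∷ []) r) n ⟩
  length (vectors (true ∷ false ∷ []) r) ^ n           ≡⟨ cong (_^ n) (length-vectors (true ∷ false ∷ []) r) ⟩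
  (2 ^ r) ^ n                                          ≡⟨ ^-*-assoc 2 r n ⟩
  2 ^ (r * n)                                          ≡⟨ cong (2 ^_) (*-comm r n) ⟩
  2 ^ (n * r)                                          ∎
  where open ≡-Reasoning

Pr≡1 : ∀ n r (A : Outcome n r → Bool) → (∀ ω → T (A ω)) → Pr n r A ≡ 1ℚ
Pr≡1 n r A certain = trans
  (cong (λ k → ℚ._/_ (ℤ.+ k) (2 ^ (n * r)) {{m^n≢0 2 (n * r)}}) (begin
    length (filterᵇ A (outcomes n r))     ≡⟨ length-filterᵇ A (outcomes n r) ⟩
    ∑[ ω ∈ outcomes n r ] 𝟙 (A ω)         ≡⟨ ∑-cong (outcomes n r) (λ ω → 𝟙-true (certain ω)) ⟩
    ∑[ ω ∈ outcomes n r ] 1               ≡⟨ ∑-one (outcomes n r) ⟩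
    length (outcomes n r)                 ≡⟨ length-outcomes n r ⟩
    2 ^ (n * r)                           ∎))
  (fraction≡1 (2 ^ (n * r)) {{m^n≢0 2 (n * r)}})
  where open ≡-Reasoning

2/3≤Pr : ∀ n r (A : Outcome n r → Bool) →
  2 * length (outcomes n r) ≤ 3 * ∑[ ω ∈ outcomes n r ] 𝟙 (A ω) → ⅔ ℚ.≤ Pr n r A
2/3≤Pr n r A h = 2/3≤fraction (length (filterᵇ A (outcomes n r))) (2 ^ (n * r)) {{m^n≢0 2 (n * r)}}
  (subst₂ (λ x y → 2 * x ≤ 3 * y) (length-outcomes n r) (sym (length-filterᵇ A (outcomes n r))) h)

-- Choosing the parameters

-- `s` is the sixth root of `x / M` rounded down to a power of two, because fair coins realise only
-- probabilities of that form; 64 is the sixth power of 2. If `x` is too small for this, `s` is 1.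
record Scale (M x : ℕ) : Set where
  field
    exponent : ℕ
  s : ℕ
  s = 2 ^ exponent
  s⁶ : ℕ
  s⁶ = s * s * s * (s * s * s)
  field
    lower : exponent ≡ 0 ⊎ M * s⁶ ≤ x
    upper : x < 64 * (M * s⁶)

  exponent≡0⇒s⁶≡1 : exponent ≡ 0 → s⁶ ≡ 1
  exponent≡0⇒s⁶≡1 e≡0 = cong (λ s → s * s * s * (s * s * s)) (cong (2 ^_) e≡0)

  s⁶≤x : 1 ≤ M → 1 ≤ x → s⁶ ≤ x
  s⁶≤x 1≤M 1≤x = case lower of λ
    { (inj₁ e≡0)   → ≤-trans (≤-reflexive (exponent≡0⇒s⁶≡1 e≡0)) 1≤x
    ; (inj₂ Ms⁶≤x) → ≤-trans (m≤n*m s⁶ M {{>-nonZero 1≤M}}) Ms⁶≤x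
    }

scale : ∀ M → 1 ≤ M → ∀ x → Scale M x
scale M 1≤M zero = record
  { exponent = 0
  ; lower    = inj₁ refl
  ; upper    = *-mono-≤ {1} {64} (s≤s z≤n) (*-mono-≤ 1≤M (s≤s {n = 0} z≤n))
  }
scale M 1≤M (suc x) = advance (64 * (M * s⁶) ≤? suc x)
  where
  open Scale (scale M 1≤M x)
  next-s⁶ : ∀ M s → 64 * (M * (s * s * s * (s * s * s))) ≡
            M * (2 * s * (2 * s) * (2 * s) * (2 * s * (2 * s) * (2 * s)))
  next-s⁶ = solve-∀
  advance : Dec (64 * (M * s⁶) ≤ suc x) → Scale M (suc x)
  advance (no 64Ms⁶≰x) = record
    { exponent = exponent ; lower = Sum.map₂ m≤n⇒m≤1+n lower ; upper = ≰⇒> 64Ms⁶≰x }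
  advance (yes 64Ms⁶≤x) = record
    { exponent = suc exponent
    ; lower    = inj₂ (≤-trans (≤-reflexive (sym (next-s⁶ M s))) 64Ms⁶≤x)
    ; upper    = begin-strict
        suc x                             ≤⟨ upper ⟩
        64 * (M * s⁶)                     <⟨ m<m+n _ (≤-trans (s≤s z≤n) upper) ⟩
        64 * (M * s⁶) + 64 * (M * s⁶)     ≡⟨ double (64 * (M * s⁶)) ⟩
        2 * (64 * (M * s⁶))               ≤⟨ *-monoˡ-≤ (64 * (M * s⁶)) {2} {64} (s≤s (s≤s z≤n)) ⟩
        64 * (64 * (M * s⁶))              ≡⟨ cong (64 *_) (next-s⁶ M s) ⟩
        64 * (M * _)                      ∎
    }
    where
    open ≤-Reasoning
    double : ∀ x → x + x ≡ 2 * x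
    double = solve-∀

-- With s about m̃^(1/6): vertices of degree above δ s³ are heavy, and for large
-- s the packing consists of ℓ s⁶ cliques.
record Constants (e C : ℕ) : Set where
  field
    δ ℓ M  : ℕ
    -- Nine times `9 * δ + 108`: the overlaps then add at most a ninth to the square of the mean.
    ℓ≡     : ℓ ≡ 81 * δ + 972
    -- Ensures that `m` is at least `50 * e` times the number `ℓ * s⁶` of cliques to be packed.
    M≡     : M ≡ 50 * (e * (C * ℓ))
    -- A factor 8 for the edges between heavy vertices, times the 64 lost in rounding `s`.
    δ²≥    : 512 * (e * (C * M)) ≤ δ * δ

-- Once `δ` is positive the affine term is at most `(c + d) * δ`, so a `δ` exceeding the whole
-- coefficient works. This resolves the circular dependence among the constants.
absorb-affine : ∀ a b c d e C → ∃ λ δ → a * (e * (C * (b * (e * (C * (c * δ + d)))))) ≤ δ * δ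
absorb-affine a b c d e C = δ , (begin
    a * (e * (C * (b * (e * (C * (c * δ + d))))))       ≡⟨ regroup a b e C (c * δ + d) ⟩
    k * (c * δ + d)                                     ≤⟨ *-monoʳ-≤ k (+-monoʳ-≤ (c * δ) (m≤m*n d δ)) ⟩
    k * (c * δ + d * δ)                                 ≡⟨ factor k c d δ ⟩
    k * (c + d) * δ                                     ≤⟨ *-monoˡ-≤ δ (n≤1+n (k * (c + d))) ⟩
    δ * δ                                               ∎)
  where
  open ≤-Reasoning
  k δ : ℕ
  k = a * b * (e * C * (e * C))
  δ = suc (k * (c + d))
  regroup : ∀ a b e C ℓ → a * (e * (C * (b * (e * (C * ℓ))))) ≡ a * b * (e * C * (e * C)) * ℓ
  regroup = solve-∀
  factor : ∀ a b c δ → a * (b * δ + c * δ) ≡ a * (b + c) * δ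
  factor = solve-∀

abstract
  constants : ∀ e C → Constants e C
  constants e C = record
    { δ   = proj₁ δ,δ²≥
    ; ℓ   = 81 * proj₁ δ,δ²≥ + 972
    ; M   = 50 * (e * (C * (81 * proj₁ δ,δ²≥ + 972)))
    ; ℓ≡  = refl
    ; M≡  = refl
    ; δ²≥ = proj₂ δ,δ²≥
    }
    where
    δ,δ²≥ : ∃ λ δ → 512 * (e * (C * (50 * (e * (C * (81 * δ + 972)))))) ≤ δ * δ
    δ,δ²≥ = absorb-affine 512 50 81 972 e C

*-positive⁻ : ∀ a b → 0 < a * b → 0 < a × 0 < b
*-positive⁻ (suc a) (suc b) _ = s≤s z≤n , s≤s z≤n
*-positive⁻ (suc a) zero    h = contradiction (subst (0 <_) (*-zeroʳ (suc a)) h) λ ()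

sixth-power : ∀ g s → (g * s) ^ 6 ≡ g ^ 6 * (s * s * s * (s * s * s))
sixth-power = expanded
  where
  expanded : ∀ g s → g * s * (g * s * (g * s * (g * s * (g * s * (g * s * 1))))) ≡
             g * (g * (g * (g * (g * (g * 1))))) * (s * s * s * (s * s * s))
  expanded = solve-∀

-- The tester: running time and soundness

module Tester (e c : ℕ) (1≤e : 1 ≤ e) where

  -- The successor keeps this factor positive when `c` is 0.
  C : ℕ
  C = suc c

  open Constants (constants e C)

  1≤ℓ : 1 ≤ ℓ
  1≤ℓ = ≤-trans (≤-trans {j = 972} (s≤s z≤n) (m≤n+m 972 (81 * δ))) (≤-reflexive (sym ℓ≡))

  1≤M : 1 ≤ M
  1≤M = ≤-trans (*-mono-≤ {1} {50} (s≤s z≤n) (*-mono-≤ 1≤e (*-mono-≤ {1} {C} (s≤s z≤n) 1≤ℓ))) (≤-reflexive (sym M≡))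

  module _ (m̃ : ℕ) where
    open Scale (scale M 1≤M m̃) public

    -- The mean load `D / q + 3` is at most `(δ + 3) * s`; Markov's inequality is applied at 27
    -- times that.
    budget : ℕ
    budget = 27 * ((δ + 3) * s)

    -- Twice the exponent of `s`, so that `q` is the square of `s` and the sampling probability is
    -- about `m̃` to the power -1/3.
    coins : ℕ
    coins = exponent + exponent

  -- The estimate 0 implies that there are no edges, and then the time bound permits no round.
  rounds : ℕ → ℕ
  rounds zero        = 0
  rounds m̃@(suc _)   = suc (budget m̃)

  tester : Algorithm
  tester = protocol rounds coins

  1≤s : ∀ m̃ → 1 ≤ s m̃
  1≤s m̃ = m^n>0 2 (exponent m̃)

  rootTime : ∀ κ → RunsInRootTime 6 κ c tester
  rootTime κ = g ^ 6 * c , λ I → bound (Input.m̃ I) (Input.m I) (proj₂ (Input.m̃-approx I))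
    where
    open ≤-Reasoning
    g : ℕ
    g = 1 + 27 * (δ + 3)
    bound : ∀ m̃ m → m̃ ≤ c * m → rounds m̃ ^ 6 ≤ g ^ 6 * c * m
    bound zero        m _    = z≤n
    bound m̃@(suc _) m m̃≤cm = begin
      suc (budget m̃) ^ 6       ≤⟨ ^-monoˡ-≤ 6 linear ⟩
      (g * s m̃) ^ 6            ≡⟨ sixth-power g (s m̃) ⟩
      g ^ 6 * s⁶ m̃             ≤⟨ *-monoʳ-≤ (g ^ 6) (≤-trans (s⁶≤x m̃ 1≤M (s≤s z≤n)) m̃≤cm) ⟩
      g ^ 6 * (c * m)          ≡⟨ *-assoc (g ^ 6) c m ⟨
      g ^ 6 * c * m            ∎
      where
      linear : suc (budget m̃) ≤ g * s m̃
      linear = +-mono-≤ (1≤s m̃) (≤-reflexive (sym (*-assoc 27 (δ + 3) (s m̃))))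

  module Soundness {κ} (I : Input κ c) (0<m : 0 < Input.m I)
    (far : ∀ H → K 5 -free H → Input.m I ≤ e * editDistance (graph (Input.network I)) H) where

    open Input I using (n; network; m̃; m; m̃-approx)
    open Protocol rounds coins I using (G; someRejects; Prob; K₅-sampled⇒someRejects)

    private
      σ D B r : ℕ
      σ = s m̃
      D = δ * (σ * σ * σ)
      B = budget m̃
      r = coins m̃

    open Packings G D
    open SecondMoment G D B r

    private
      open ≤-Reasoning

      q≡σ² : q ≡ σ * σ
      q≡σ² = trans (length-vectors (true ∷ false ∷ []) r) (^-distribˡ-+-* 2 (exponent m̃) (exponent m̃))

      q³≡s⁶ : q³ ≡ s⁶ m̃
      q³≡s⁶ = trans (cong (λ q → q * q * q) q≡σ²) (regroup σ)
        where
        regroup : ∀ s → s * s * (s * s) * (s * s) ≡ s * s * s * (s * s * s)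
        regroup = solve-∀

      σ²≤σ³ : σ * σ ≤ σ * σ * σ
      σ²≤σ³ = m≤m*n (σ * σ) σ {{>-nonZero (1≤s m̃)}}

      m≤Cm̃ : m ≤ C * m̃
      m≤Cm̃ = ≤-trans (proj₁ m̃-approx) (*-monoˡ-≤ m̃ (n≤1+n c))

      m̃≤Cm : m̃ ≤ C * m
      m̃≤Cm = ≤-trans (proj₂ m̃-approx) (*-monoˡ-≤ m (n≤1+n c))

      rounds≡ : rounds m̃ ≡ suc B
      rounds≡ = positive m̃ m≤Cm̃
        where
        positive : ∀ m̃ → m ≤ C * m̃ → rounds m̃ ≡ suc (budget m̃)
        positive zero    m≤0 = contradiction (≤-trans 0<m (≤-trans m≤0 (≤-reflexive (*-zeroʳ C)))) λ ()
        positive (suc _) _   = refl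

      8em≤D² : 8 * (e * m) ≤ D * D
      8em≤D² = begin
        8 * (e * m)
          ≤⟨ *-monoʳ-≤ 8 (*-monoʳ-≤ e (≤-trans m≤Cm̃ (*-monoʳ-≤ C (<⇒≤ (upper m̃))))) ⟩
        8 * (e * (C * (64 * (M * s⁶ m̃))))
          ≡⟨ collect e C M (s⁶ m̃) ⟩
        512 * (e * (C * M)) * s⁶ m̃
          ≤⟨ *-monoˡ-≤ (s⁶ m̃) δ²≥ ⟩
        δ * δ * s⁶ m̃
          ≡⟨ regroup δ (σ * σ * σ) ⟩
        D * D ∎
        where
        collect : ∀ e C M x → 8 * (e * (C * (64 * (M * x)))) ≡ 512 * (e * (C * M)) * x
        collect = solve-∀
        regroup : ∀ a b → a * a * (b * b) ≡ a * b * (a * b)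
        regroup = solve-∀

      -- Squaring `#heavy * D ≤ 2 * m` and dividing by `8em≤D²` spends half of the `m / e` edits on
      -- heavy pairs; the other half is left for the edges of the packing.
      few-heavy : 2 * (e * (#heavy * #heavy)) ≤ m
      few-heavy = *-cancelˡ-≤ (8 * (e * m)) {{>-nonZero (*-mono-≤ {1} {8} (s≤s z≤n) (*-mono-≤ 1≤e 0<m))}} (begin
        8 * (e * m) * (2 * (e * (#heavy * #heavy)))
          ≤⟨ *-monoˡ-≤ _ 8em≤D² ⟩
        D * D * (2 * (e * (#heavy * #heavy)))
          ≡⟨ regroup D e #heavy ⟩
        2 * e * (#heavy * D * (#heavy * D))
          ≤⟨ *-monoʳ-≤ (2 * e) (*-mono-≤ #heavy*D≤ #heavy*D≤) ⟩
        2 * e * (2 * m * (2 * m))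
          ≡⟨ regroup′ e m ⟩
        8 * (e * m) * m ∎)
        where
        regroup : ∀ D e h → D * D * (2 * (e * (h * h))) ≡ 2 * e * (h * D * (h * D))
        regroup = solve-∀
        regroup′ : ∀ e m → 2 * e * (2 * m * (2 * m)) ≡ 8 * (e * m) * m
        regroup′ = solve-∀

      fits : 27 * (D + 3 * q) ≤ q * suc B
      fits = begin
        27 * (δ * (σ * σ * σ) + 3 * q)
          ≡⟨ cong (λ q → 27 * (δ * (σ * σ * σ) + 3 * q)) q≡σ² ⟩
        27 * (δ * (σ * σ * σ) + 3 * (σ * σ))
          ≤⟨ *-monoʳ-≤ 27 (+-monoʳ-≤ (δ * (σ * σ * σ)) (*-monoʳ-≤ 3 σ²≤σ³)) ⟩
        27 * (δ * (σ * σ * σ) + 3 * (σ * σ * σ))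
          ≡⟨ regroup δ σ ⟩
        σ * σ * B
          ≤⟨ *-monoʳ-≤ (σ * σ) (n≤1+n B) ⟩
        σ * σ * suc B
          ≡⟨ cong (_* suc B) q≡σ² ⟨
        q * suc B ∎
        where
        regroup : ∀ δ σ → 27 * (δ * (σ * σ * σ) + 3 * (σ * σ * σ)) ≡ σ * σ * (27 * ((δ + 3) * σ))
        regroup = solve-∀

      detects : ∀ K ω → 0 < detected K ω → T (someRejects ω)
      detects K ω pos =
        K₅-sampled⇒someRejects rounds≡ (vertex K) (adjacent K) ω all-sampled
          (toWitness {a? = speakers-fit? K ω} (1≤𝟙⇒T (proj₂ sampled×fit)))
        where
        sampled×fit : 0 < hits (core K) ω × 0 < 𝟙 (isYes (speakers-fit? K ω))
        sampled×fit = *-positive⁻ (hits (core K) ω) _ pos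
        mark : Fin 3 → Bool
        mark i = unanimous (lookup ω (vertex K (suc (suc i))))
        after₁ : 0 < 𝟙 (mark zero) × 0 < 𝟙 (mark (suc zero)) * (𝟙 (mark (suc (suc zero))) * 1)
        after₁ = *-positive⁻ (𝟙 (mark zero)) _ (proj₁ sampled×fit)
        after₂ : 0 < 𝟙 (mark (suc zero)) × 0 < 𝟙 (mark (suc (suc zero))) * 1
        after₂ = *-positive⁻ (𝟙 (mark (suc zero))) _ (proj₂ after₁)
        all-sampled : ∀ i → T (mark i)
        all-sampled zero             = 1≤𝟙⇒T (proj₁ after₁)
        all-sampled (suc zero)       = 1≤𝟙⇒T (proj₁ after₂)
        all-sampled (suc (suc zero)) = 1≤𝟙⇒T (proj₁ (*-positive⁻ (𝟙 (mark (suc (suc zero)))) _ (proj₂ after₂)))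

      Variance : ℕ → List LightClique → Set
      Variance λ′ P = 9 * ∑[ ω ∈ Ωs ] (#sampled P ω * #sampled P ω) ≤ 10 * (λ′ * λ′ * #Ω)

      -- The packing is known only up to double negation, which the decidable comparison of
      -- rationals removes.
      rejects-if : ∀ k λ′ → 1 ≤ λ′ → k ≡ λ′ * q³ → 50 * e * pred k < m →
        (∀ P → length P ≡ k → IsPacking P → Variance λ′ P) → ⅔ ℚ.≤ Prob someRejects
      rejects-if k λ′ 1≤λ′ k≡ small variance = decidable-stable (_ ℚ.≤? _) λ unlikely →
        packing-exists e far few-heavy k small λ (P , ∣P∣≡k , packing) →
          unlikely (2/3≤Pr n r someRejects
            (likely {P} packing λ′ 1≤λ′ (trans ∣P∣≡k k≡) fits (variance P ∣P∣≡k packing) someRejects detects))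

      -- Here `s` is 1: no coin is tossed and every node is sampled, so a packing of one clique
      -- suffices and the sampled count never exceeds 1.
      rejects-small : exponent m̃ ≡ 0 → ⅔ ℚ.≤ Prob someRejects
      rejects-small exponent≡0 = rejects-if 1 1 ≤-refl 1≡q³ (≤-trans (≤-reflexive (cong suc (*-zeroʳ (50 * e)))) 0<m)
        λ P ∣P∣≡1 _ → begin
          9 * ∑[ ω ∈ Ωs ] (#sampled P ω * #sampled P ω)
            ≤⟨ *-monoʳ-≤ 9 (∑-≤const Ωs λ ω → *-mono-≤ (at-most-one P ∣P∣≡1 ω) (at-most-one P ∣P∣≡1 ω)) ⟩
          9 * (#Ω * 1)
            ≡⟨ cong (9 *_) (*-comm #Ω 1) ⟩
          9 * (1 * #Ω)
            ≤⟨ *-monoˡ-≤ (1 * #Ω) (n≤1+n 9) ⟩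
          10 * (1 * 1 * #Ω) ∎
        where
        1≡q³ : 1 ≡ 1 * q³
        1≡q³ = sym (trans (+-identityʳ q³) (trans q³≡s⁶ (exponent≡0⇒s⁶≡1 m̃ exponent≡0)))
        at-most-one : ∀ P → length P ≡ 1 → ∀ ω → #sampled P ω ≤ 1
        at-most-one P ∣P∣≡1 ω = ≤-trans (∑-≤const P λ K → hits≤1 (core K) ω)
          (≤-reflexive (trans (*-identityʳ _) ∣P∣≡1))

      -- The size `ℓ * q³` of the packing makes the mean number of sampled cliques exactly `ℓ`.
      rejects-large : M * s⁶ m̃ ≤ m̃ → ⅔ ℚ.≤ Prob someRejects
      rejects-large Ms⁶≤m̃ = rejects-if k ℓ 1≤ℓ refl small λ P ∣P∣≡k packing → *-cancelˡ-≤ (q³ * q³) {{q⁶≢0}} (begin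
          q³ * q³ * (9 * S P)
            ≡⟨ x∙yz≈y∙xz (q³ * q³) 9 _ ⟩
          9 * (q³ * q³ * S P)
            ≤⟨ *-monoʳ-≤ 9 (second-moment {P} packing) ⟩
          9 * (length P * ((length P + W) * #Ω))
            ≡⟨ cong (λ k → 9 * (k * ((k + W) * #Ω))) ∣P∣≡k ⟩
          9 * (k * ((k + W) * #Ω))
            ≡⟨ regroup k W #Ω ⟩
          k * ((9 * k + 9 * W) * #Ω)
            ≤⟨ *-monoʳ-≤ k (*-monoˡ-≤ #Ω (+-monoʳ-≤ (9 * k) 9W≤k)) ⟩
          k * ((9 * k + k) * #Ω)
            ≡⟨ regroup′ ℓ q³ #Ω ⟩
          q³ * q³ * (10 * (ℓ * ℓ * #Ω)) ∎)
        where
        open import Algebra.Properties.CommutativeSemigroup *-commutativeSemigroup using (x∙yz≈y∙xz)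
        k W : ℕ
        k = ℓ * q³
        W = 9 * (D * q) + 108 * q³
        S : List LightClique → ℕ
        S P = ∑[ ω ∈ Ωs ] (#sampled P ω * #sampled P ω)
        regroup : ∀ k W N → 9 * (k * ((k + W) * N)) ≡ k * ((9 * k + 9 * W) * N)
        regroup = solve-∀
        regroup′ : ∀ ℓ x N → ℓ * x * ((9 * (ℓ * x) + ℓ * x) * N) ≡ x * x * (10 * (ℓ * ℓ * N))
        regroup′ = solve-∀
        1≤q³ : 1 ≤ q³
        1≤q³ = *-mono-≤ (*-mono-≤ q≥1 q≥1) q≥1
        q⁶≢0 : NonZero (q³ * q³)
        q⁶≢0 = >-nonZero (*-mono-≤ 1≤q³ 1≤q³)
        9W≤k : 9 * W ≤ k
        9W≤k = begin
          9 * (9 * (D * q) + 108 * q³)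
            ≤⟨ *-monoʳ-≤ 9 (+-monoˡ-≤ (108 * q³) (*-monoʳ-≤ 9 Dq≤)) ⟩
          9 * (9 * (δ * q³) + 108 * q³)
            ≡⟨ regroup″ δ q³ ⟩
          (81 * δ + 972) * q³
            ≡⟨ cong (_* q³) ℓ≡ ⟨
          ℓ * q³ ∎
          where
          regroup″ : ∀ δ x → 9 * (9 * (δ * x) + 108 * x) ≡ (81 * δ + 972) * x
          regroup″ = solve-∀
          -- The fifth power of `s` is relaxed to the sixth, so that a constant `ℓ` serves every
          -- scale.
          Dq≤ : D * q ≤ δ * q³
          Dq≤ = begin
            D * q                                  ≡⟨ cong (D *_) q≡σ² ⟩
            δ * (σ * σ * σ) * (σ * σ)              ≡⟨ *-assoc δ _ _ ⟩
            δ * (σ * σ * σ * (σ * σ))              ≤⟨ *-monoʳ-≤ δ (*-monoʳ-≤ (σ * σ * σ) σ²≤σ³) ⟩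
            δ * (σ * σ * σ * (σ * σ * σ))          ≡⟨ cong (δ *_) q³≡s⁶ ⟨
            δ * q³                                 ∎
        1≤k : 1 ≤ k
        1≤k = *-mono-≤ 1≤ℓ 1≤q³
        50ek≤m : 50 * e * k ≤ m
        50ek≤m = *-cancelˡ-≤ C (begin
          C * (50 * e * (ℓ * q³))               ≡⟨ regroup‴ C e ℓ q³ ⟩
          50 * (e * (C * ℓ)) * q³               ≡⟨ cong₂ _*_ (sym M≡) q³≡s⁶ ⟩
          M * s⁶ m̃                              ≤⟨ ≤-trans Ms⁶≤m̃ m̃≤Cm ⟩
          C * m                                 ∎)
          where
          regroup‴ : ∀ C e ℓ x → C * (50 * e * (ℓ * x)) ≡ 50 * (e * (C * ℓ)) * x
          regroup‴ = solve-∀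
        small : 50 * e * pred k < m
        small = begin-strict
          50 * e * pred k   <⟨ *-monoʳ-< (50 * e) {{>-nonZero (*-mono-≤ {1} {50} (s≤s z≤n) 1≤e)}}
                                 (≤-reflexive (suc-pred k {{>-nonZero 1≤k}})) ⟩
          50 * e * k        ≤⟨ 50ek≤m ⟩
          m                 ∎

    rejects : ⅔ ℚ.≤ Prob someRejects
    rejects = [ rejects-small , rejects-large ]′ (lower m̃)

corollary6p5 : ∀ (ε : ℚ) → 0ℚ ℚ.< ε → ε ℚ.≤ 1ℚ →
    ∀ (κ c : ℕ) →
    Σ Algorithm λ 𝓐 →
    InCONGEST κ c 𝓐 ×
    Tests K 5 -free ε κ c 𝓐 ×
    OneSided K 5 -free κ c 𝓐 ×
    RunsInRootTime 6 κ c 𝓐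
corollary6p5 ε 0<ε _ κ c =
  tester
  , (suc κ , Protocol.respectsBandwidth rounds coins)
  , record
      { complete₂₃ = λ I free → subst (⅔ ℚ.≤_) (sym (oneSided I free)) 2/3≤1
      ; sound₂₃    = λ I 0<m far → Soundness.rejects I 0<m λ H free → ε*m≤d⇒m≤↧ε*d ε 0<ε (far H free)
      }
  , oneSided
  , rootTime κ
  where
  open Tester (ℚ.↧ₙ ε) c (s≤s z≤n)
  oneSided : OneSided K 5 -free κ c tester
  oneSided I free = Pr≡1 (Input.n I) (coins (Input.m̃ I)) _ (Protocol.K₅-free⇒allAccept rounds coins I free)
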